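{- The SoftMHV problem can be approximated within a factor of $1/k$ in polynomial time, where $k$ is the number of colors. That is, there is a polynomial-time algorithm which, on every SoftMHV instance, outputs a total vertex coloring extending the given partial coloring whose number of happy vertices is at least $\frac1k\cdot OPT$, where $OPT$ is the maximum number of happy vertices over all total colorings extending the given partial coloring.
   Context: SoftMHV problem (Maximum Happy Vertices with soft threshold): let $\rho\in(0,1)$ be a number (either a constant or part of the input). An instance consists of a connected undirected graph $G=(V,E)$, a color set $C=\{1,2,\ldots,k\}$, and a partial vertex coloring $c\colon V\to C$ (i.e. $c$ assigns colors to only part of the vertices). Under a total coloring $c'\colon V\to C$, a vertex $v$ is happy if at least $\rho\cdot\deg(v)$ of its neighbors have the same color as $v$. The task is to find a total coloring extending $c$ (agreeing with $c$ wherever $c$ is defined) that maximizes the number of happy vertices.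
   Formalization: The threshold ρ is a rational number in (0,1) given as part of the input; an irrational constant threshold ρ is not covered. -}

module Defs where

open import Data.Bool using (Bool; true; false; T)
open import Data.Bool.Properties using (T?)
open import Data.Fin using (Fin; toℕ)
import Data.Fin.Properties as Fin
open import Data.Integer using (+_; ∣_∣)
open import Data.List using (List; []; _∷_; length; map; filter; allFin; cartesianProductWith)
open import Data.List.Extrema.Nat using (max)
open import Data.Maybe using (Maybe; just; nothing)
import Data.Maybe.Relation.Unary.All as Maybe
open import Data.Nat using (ℕ; zero; suc; _+_; _*_; _^_; _≤_; NonZero)
open import Data.Nat.Binary using (ℕᵇ; zero; 2[1+_]; 1+[2_]; fromℕ)
open import Data.Product using (Σ; Σ-syntax; ∃-syntax; _×_; _,_)
open import Data.Rational as ℚ using (ℚ; 0ℚ; 1ℚ; ↥_; ↧ₙ_; _/_)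
import Data.Rational.Properties as ℚ
open import Data.Vec using (Vec; []; _∷_; lookup; replicate; toList; _[_]≔_)
open import Relation.Binary.Construct.Closure.ReflexiveTransitive using (Star)
open import Relation.Binary.PropositionalEquality using (_≡_)
open import Relation.Nullary using (¬_; Dec)

------------------------------------------------------------------------
-- Polynomial time.
--
-- The machine model is Jones' WHILE language (N. D. Jones, "Computability
-- and Complexity from a Programming Perspective", MIT Press 1997): programs
-- with finitely many variables ranging over binary trees, whose only
-- primitives are nil, cons, hd, tl and the test for nil.  Each primitive
-- inspects or creates at most one node, so it costs one time unit.  For
-- problems whose solutions have polynomially bounded size, polynomial time on
-- this model and on Turing machines coincide.

data Data : Set where
  nil  : Data
  cons : Data → Data → Data

size : Data → ℕ
size nil        = 1
size (cons d e) = 1 + size d + size e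

data Expr (m : ℕ) : Set where
  var    : Fin m → Expr m
  nil    : Expr m
  cons   : Expr m → Expr m → Expr m
  hd tl  : Expr m → Expr m

infix  6 _:=_
infixr 5 _⨾_

data Cmd (m : ℕ) : Set where
  skip          : Cmd m
  _:=_          : Fin m → Expr m → Cmd m
  _⨾_           : Cmd m → Cmd m → Cmd m
  if_then_else_ : Expr m → Cmd m → Cmd m → Cmd m
  while_loop_     : Expr m → Cmd m → Cmd m

Store : ℕ → Set
Store m = Vec Data m

head tail : Data → Data
head nil        = nil
head (cons d e) = d
tail nil        = nil
tail (cons d e) = e

⟦_⟧ : ∀ {m} → Expr m → Store m → Data
⟦ var x    ⟧ σ = lookup σ x
⟦ nil      ⟧ σ = nil
⟦ cons e f ⟧ σ = cons (⟦ e ⟧ σ) (⟦ f ⟧ σ)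
⟦ hd e     ⟧ σ = head (⟦ e ⟧ σ)
⟦ tl e     ⟧ σ = tail (⟦ e ⟧ σ)

cost : ∀ {m} → Expr m → ℕ
cost (var x)    = 1
cost nil        = 1
cost (cons e f) = 1 + cost e + cost f
cost (hd e)     = 1 + cost e
cost (tl e)     = 1 + cost e

-- ⟨ c , σ ⟩⇓[ t ] τ : started in store σ, the command c halts in store τ
-- after t time units.  In tests, nil is false and every other tree is true.

data ⟨_,_⟩⇓[_]_ {m : ℕ} : Cmd m → Store m → ℕ → Store m → Set where

  skip : ∀ {σ} → ⟨ skip , σ ⟩⇓[ 1 ] σ

  assign : ∀ {x e σ} → ⟨ x := e , σ ⟩⇓[ 1 + cost e ] (σ [ x ]≔ ⟦ e ⟧ σ)

  seq : ∀ {c d σ τ υ s t} →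
        ⟨ c , σ ⟩⇓[ s ] τ → ⟨ d , τ ⟩⇓[ t ] υ → ⟨ c ⨾ d , σ ⟩⇓[ s + t ] υ

  if-true : ∀ {e c d σ τ t} → ¬ (⟦ e ⟧ σ ≡ nil) → ⟨ c , σ ⟩⇓[ t ] τ →
            ⟨ if e then c else d , σ ⟩⇓[ 1 + cost e + t ] τ

  if-false : ∀ {e c d σ τ t} → ⟦ e ⟧ σ ≡ nil → ⟨ d , σ ⟩⇓[ t ] τ →
             ⟨ if e then c else d , σ ⟩⇓[ 1 + cost e + t ] τ

  while-true : ∀ {e c σ τ υ s t} → ¬ (⟦ e ⟧ σ ≡ nil) →
               ⟨ c , σ ⟩⇓[ s ] τ → ⟨ while e loop c , τ ⟩⇓[ t ] υ →
               ⟨ while e loop c , σ ⟩⇓[ 1 + cost e + s + t ] υ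

  while-false : ∀ {e c σ} → ⟦ e ⟧ σ ≡ nil →
                ⟨ while e loop c , σ ⟩⇓[ 1 + cost e ] σ

-- Variable 0 holds the input initially and the output finally; the remaining
-- variables are initialised to nil.

record Program : Set where
  constructor program
  field
    extraVars : ℕ
    body      : Cmd (suc extraVars)

_∋_↦_inTime_ : Program → Data → Data → ℕ → Set
program m c ∋ input ↦ output inTime t =
  Σ[ τ ∈ Store m ] ⟨ c , input ∷ replicate m nil ⟩⇓[ t ] (output ∷ τ)

-- One fixed program that, on every instance, outputs (the encoding of) some
-- solution related to the instance by R, in time polynomial in the size of the
-- encoded instance.

SolvableInPolynomialTime :
  {Inst : Set} {Sol : Inst → Set}
  (encodeInst : Inst → Data) (encodeSol : ∀ {I} → Sol I → Data)
  (R : (I : Inst) → Sol I → Set) → Set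
SolvableInPolynomialTime {Inst} {Sol} encodeInst encodeSol R =
  ∃[ P ] ∃[ a ] ∃[ b ] ∃[ d ]
    ((I : Inst) → Σ[ s ∈ Sol I ] Σ[ t ∈ ℕ ]
      P ∋ encodeInst I ↦ encodeSol s inTime t ×
      t ≤ a * size (encodeInst I) ^ d + b ×
      R I s)

------------------------------------------------------------------------
-- The SoftMHV problem

record Graph (n : ℕ) : Set where
  field
    adj   : Fin n → Fin n → Bool
    sym   : ∀ u v → adj u v ≡ adj v u
    irref : ∀ v → adj v v ≡ false

  Adj : Fin n → Fin n → Set
  Adj u v = T (adj u v)

  Connected : Set
  Connected = ∀ u v → Star Adj u v

  neighbours : Fin n → List (Fin n)
  neighbours v = filter (λ u → T? (adj v u)) (allFin n)

  deg : Fin n → ℕ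
  deg v = length (neighbours v)

-- The colour called i ∈ {1,…,k} is the element of Fin k with toℕ equal to
-- i - 1.  The threshold ρ is part of the instance, hence rational.

record Instance : Set where
  field
    ρ         : ℚ
    0<ρ       : 0ℚ ℚ.< ρ
    ρ<1       : ρ ℚ.< 1ℚ
    n         : ℕ
    G         : Graph n
    connected : Graph.Connected G
    k         : ℕ
    {{k≢0}}   : NonZero k
    c         : Vec (Maybe (Fin k)) n

  open Graph G public

TotalColouring : Instance → Set
TotalColouring I = Vec (Fin k) n
  where open Instance I

allVecs : {A : Set} → List A → (n : ℕ) → List (Vec A n)
allVecs xs zero    = [] ∷ []
allVecs xs (suc n) = cartesianProductWith _∷_ xs (allVecs xs n)

module _ (I : Instance) where
  open Instance I

  Extends : TotalColouring I → Set
  Extends c′ = ∀ v → Maybe.All (λ i → lookup c′ v ≡ i) (lookup c v)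

  extends? : ∀ c′ → Dec (Extends c′)
  extends? c′ = Fin.all? λ v → Maybe.dec (λ i → lookup c′ v Fin.≟ i) (lookup c v)

  sameColourNeighbours : TotalColouring I → Fin n → List (Fin n)
  sameColourNeighbours c′ v =
    filter (λ u → lookup c′ u Fin.≟ lookup c′ v) (neighbours v)

  Happy : TotalColouring I → Fin n → Set
  Happy c′ v = ρ ℚ.* (+ deg v / 1) ℚ.≤ + length (sameColourNeighbours c′ v) / 1

  happy? : ∀ c′ v → Dec (Happy c′ v)
  happy? c′ v =
    (ρ ℚ.* (+ deg v / 1)) ℚ.≤? (+ length (sameColourNeighbours c′ v) / 1)

  numHappy : TotalColouring I → ℕ
  numHappy c′ = length (filter (happy? c′) (allFin n))

  -- The default value 0 of the maximum is never decisive: since k ≥ 1, the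
  -- list of extensions is nonempty.
  OPT : ℕ
  OPT = max 0 (map numHappy (filter extends? (allVecs (allFin k) n)))

  IsApproximation : ℚ → TotalColouring I → Set
  IsApproximation α c′ =
    Extends c′ × α ℚ.* (+ OPT / 1) ℚ.≤ + numHappy c′ / 1

------------------------------------------------------------------------
-- Encoding of instances and solutions as trees

encodeBool : Bool → Data
encodeBool false = nil
encodeBool true  = cons nil nil

encodeList : {A : Set} → (A → Data) → List A → Data
encodeList f []       = nil
encodeList f (x ∷ xs) = cons (f x) (encodeList f xs)

encodeMaybe : {A : Set} → (A → Data) → Maybe A → Data
encodeMaybe f nothing  = nil
encodeMaybe f (just x) = cons nil (f x)

-- Numbers are written in binary (the bijective numeration of ℕᵇ, least
-- significant digit first), so their size is logarithmic in their value.
encodeℕᵇ : ℕᵇ → Data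
encodeℕᵇ zero     = nil
encodeℕᵇ 2[1+ x ] = cons (cons nil nil) (encodeℕᵇ x)
encodeℕᵇ 1+[2 x ] = cons nil (encodeℕᵇ x)

encodeℕ : ℕ → Data
encodeℕ m = encodeℕᵇ (fromℕ m)

encodeColour : ∀ {k} → Fin k → Data
encodeColour i = encodeℕ (suc (toℕ i))

-- Positive rationals as a pair of numerator and denominator in lowest terms.
encodeℚ⁺ : ℚ → Data
encodeℚ⁺ q = cons (encodeℕ ∣ ↥ q ∣) (encodeℕ (↧ₙ q))

-- The graph is given by its adjacency matrix, and the colour set, like the
-- vertex set, is listed explicitly.
encodeInstance : Instance → Data
encodeInstance I =
  cons (encodeℚ⁺ ρ)
  (cons (encodeList (λ v → encodeList (λ u → encodeBool (adj v u)) (allFin n)) (allFin n))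
  (cons (encodeList encodeColour (allFin k))
        (encodeList (encodeMaybe encodeColour) (toList c))))
  where open Instance I

encodeColouring : ∀ {I} → TotalColouring I → Data
encodeColouring c′ = encodeList encodeColour (toList c′)

-- α I is the guaranteed ratio on instance I.
SoftMHV-ApproximableInPolynomialTime : ((I : Instance) → ℚ) → Set
SoftMHV-ApproximableInPolynomialTime α =
  SolvableInPolynomialTime {Sol = TotalColouring} encodeInstance
    (λ {I} → encodeColouring {I}) (λ I → IsApproximation I (α I))

{-# OPTIONS --safe #-}

-- For each colour i, give i to all uncoloured vertices and count the happy vertices of
-- colour i; output the colouring with the largest count.  A vertex that is happy in
-- an optimal colouring, with colour i there, stays happy in the i-th of these colourings,
-- because it and all its neighbours of colour i still have colour i.  So the k counts
-- sum up to at least OPT.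
--
-- Polynomial time: functions between encodable types with a WHILE program and polynomial
-- bounds on its running time and on the size of its value are closed under composition,
-- pairing, case distinction and folds whose accumulator grows by a bounded amount per step.

module Submission where

-- The obstacle to polynomial time is the threshold. Numerator and denominator of `ρ` are written in
-- binary, so their values can be exponential in the size of the input, and neither may be expanded
-- to unary. Counts of vertices, in contrast, are small enough for unary. The test for happiness
-- becomes a comparison of two products, each of a binary numeral by a unary number. It is decided
-- digit by digit, with unary carries whose size grows only additively, as the folds demand. Testing
-- whether two colours are equal reduces to the same comparison. The number of colours is no
-- obstacle: the colour set is listed explicitly, so one pass over the graph per colour is
-- affordable.

open import Defs
open import Data.Bool using (Bool; true; false; not; _∧_; T) renaming (if_then_else_ to when_then_else_)
open import Data.Bool.Properties using (T?; T-∧)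
open import Data.Fin using (Fin; zero; suc; toℕ)
import Data.Fin.Properties as Fin
open import Data.Integer as ℤ using (+_; -[1+_]; ∣_∣)
import Data.Integer.Properties as ℤ
open import Data.List as List using (List; []; _∷_; _++_; length; filter; filterᵇ; replicate; zip; allFin; tabulate)
open import Data.List.Extrema.Nat using (max≤v⁺)
open import Data.List.Membership.Propositional using (_∈_)
open import Data.List.Membership.Propositional.Properties using (∈-allFin)
open import Data.List.Properties
  using (filter-≐; foldl-++; length-++; length-tabulate; map-∘; map-cong; map-is-foldr; map-tabulate;
         reverse-foldl; reverse-involutive; tabulate-cong)
import Data.List.Relation.Unary.All as All
import Data.List.Relation.Unary.All.Properties as All
open import Data.List.Relation.Unary.Any using (here; there)
open import Data.Maybe as Maybe using (Maybe; just; nothing; maybe′; fromMaybe)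
import Data.Maybe.Relation.Unary.All as MaybeAll
open import Data.Nat hiding (_/_)
open import Data.Nat.Binary as ℕᵇ using (ℕᵇ; zero; 2[1+_]; 1+[2_]; fromℕ)
import Data.Nat.Binary.Properties as ℕᵇ
open import Data.Nat.GeneralisedArithmetic using (fold)
open import Data.Nat.ListAction using (sum)
open import Data.Nat.Properties
open import Data.Nat.Tactic.RingSolver using (solve-∀)
open import Data.Product using (Σ-syntax; ∃-syntax; _×_; _,_; proj₁; proj₂)
open import Data.Rational as ℚ using (0ℚ; mkℚ; ↥_; ↧ₙ_; toℚᵘ; fromℚᵘ; _/_)
import Data.Rational.Properties as ℚ
open import Data.Rational.Unnormalised as ℚᵘ using (mkℚᵘ; *≤*)
import Data.Rational.Unnormalised.Properties as ℚᵘ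
open import Data.Unit using (⊤; tt)
open import Data.Vec as Vec using (Vec; []; _∷_; lookup; toList)
import Data.Vec.Properties as Vec
open import Function using (_∘_; id; Equivalence)
open import Relation.Binary.PropositionalEquality
open import Relation.Nullary using (¬_; yes; no; contradiction)
open import Relation.Unary using (Decidable)
open import Relation.Unary.Properties using (_∩?_)

-- Polynomial bounds

infixl 6 _⊕_
infixl 7 _⊗_
infixr 9 _⊙_

-- A syntax closed under composition lets bounds follow the structure of programs. Without
-- subtraction all its functions are monotone, so an upper bound on a size may replace the size. The
-- form `a * n ^ d` is computed only once, for the final program.
data Polynomial : Set where
  𝐱           : Polynomial
  con         : ℕ → Polynomial
  _⊕_ _⊗_ _⊙_ : Polynomial → Polynomial → Polynomial

_⟨_⟩ : Polynomial → ℕ → ℕ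
𝐱       ⟨ n ⟩ = n
con c   ⟨ n ⟩ = c
(p ⊕ q) ⟨ n ⟩ = p ⟨ n ⟩ + q ⟨ n ⟩
(p ⊗ q) ⟨ n ⟩ = p ⟨ n ⟩ * q ⟨ n ⟩
(p ⊙ q) ⟨ n ⟩ = p ⟨ q ⟨ n ⟩ ⟩

⟨⟩-mono : ∀ p {m n} → m ≤ n → p ⟨ m ⟩ ≤ p ⟨ n ⟩
⟨⟩-mono 𝐱       m≤n = m≤n
⟨⟩-mono (con c) m≤n = ≤-refl
⟨⟩-mono (p ⊕ q) m≤n = +-mono-≤ (⟨⟩-mono p m≤n) (⟨⟩-mono q m≤n)
⟨⟩-mono (p ⊗ q) m≤n = *-mono-≤ (⟨⟩-mono p m≤n) (⟨⟩-mono q m≤n)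
⟨⟩-mono (p ⊙ q) m≤n = ⟨⟩-mono p (⟨⟩-mono q m≤n)

^-distribʳ-* : ∀ m n d → (m * n) ^ d ≡ m ^ d * n ^ d
^-distribʳ-* m n zero    = refl
^-distribʳ-* m n (suc d) = begin
  m * n * (m * n) ^ d     ≡⟨ cong (m * n *_) (^-distribʳ-* m n d) ⟩
  m * n * (m ^ d * n ^ d) ≡⟨ [m*n]*[o*p]≡[m*o]*[n*p] m n (m ^ d) (n ^ d) ⟩
  m * m ^ d * (n * n ^ d) ∎
  where open ≡-Reasoning

-- The coefficient is positive so that, for p ⊙ q, the bound on q is a nonzero argument for p.
monomialBound : ∀ p → ∃[ a ] ∃[ d ] (∀ n .{{_ : NonZero n}} → p ⟨ n ⟩ ≤ suc a * n ^ d)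
monomialBound 𝐱 = 0 , 1 , λ n → ≤-reflexive (trans (sym (*-identityʳ n)) (sym (+-identityʳ (n * 1))))
monomialBound (con c) = c , 0 , λ n → ≤-trans (n≤1+n c) (≤-reflexive (sym (*-identityʳ (suc c))))
monomialBound (p ⊕ q) with monomialBound p | monomialBound q
... | a , d , p≤ | b , e , q≤ = a + suc b , d + e , λ n → begin
  p ⟨ n ⟩ + q ⟨ n ⟩                           ≤⟨ +-mono-≤ (p≤ n) (q≤ n) ⟩
  suc a * n ^ d + suc b * n ^ e               ≤⟨ +-mono-≤ (*-monoʳ-≤ (suc a) (^-monoʳ-≤ n (m≤m+n d e)))
                                                          (*-monoʳ-≤ (suc b) (^-monoʳ-≤ n (m≤n+m e d))) ⟩
  suc a * n ^ (d + e) + suc b * n ^ (d + e)   ≡⟨ *-distribʳ-+ (n ^ (d + e)) (suc a) (suc b) ⟨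
  (suc a + suc b) * n ^ (d + e)               ∎
  where open ≤-Reasoning
monomialBound (p ⊗ q) with monomialBound p | monomialBound q
... | a , d , p≤ | b , e , q≤ = b + a * suc b , d + e , λ n → begin
  p ⟨ n ⟩ * q ⟨ n ⟩                     ≤⟨ *-mono-≤ (p≤ n) (q≤ n) ⟩
  suc a * n ^ d * (suc b * n ^ e)       ≡⟨ [m*n]*[o*p]≡[m*o]*[n*p] (suc a) (n ^ d) (suc b) (n ^ e) ⟩
  suc a * suc b * (n ^ d * n ^ e)       ≡⟨ cong (suc a * suc b *_) (^-distribˡ-+-* n d e) ⟨
  suc a * suc b * n ^ (d + e)           ∎
  where open ≤-Reasoning
monomialBound (p ⊙ q) with monomialBound p | monomialBound q
... | a , d , p≤ | b , e , q≤ = suc a * suc b ^ d , e * d , λ n →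
  let instance
        n^e≢0 : NonZero (n ^ e)
        n^e≢0 = m^n≢0 n e
        bn^e≢0 : NonZero (suc b * n ^ e)
        bn^e≢0 = m*n≢0 (suc b) (n ^ e)
  in begin
  p ⟨ q ⟨ n ⟩ ⟩                             ≤⟨ ⟨⟩-mono p (q≤ n) ⟩
  p ⟨ suc b * n ^ e ⟩                       ≤⟨ p≤ (suc b * n ^ e) ⟩
  suc a * (suc b * n ^ e) ^ d               ≡⟨ cong (suc a *_) (^-distribʳ-* (suc b) (n ^ e) d) ⟩
  suc a * (suc b ^ d * (n ^ e) ^ d)         ≡⟨ *-assoc (suc a) (suc b ^ d) _ ⟨
  suc a * suc b ^ d * (n ^ e) ^ d           ≡⟨ cong (suc a * suc b ^ d *_) (^-*-assoc n e d) ⟩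
  suc a * suc b ^ d * n ^ (e * d)           ≤⟨ *-monoˡ-≤ (n ^ (e * d)) (n≤1+n (suc a * suc b ^ d)) ⟩
  suc (suc a * suc b ^ d) * n ^ (e * d)     ∎
  where open ≤-Reasoning

-- Encodable types

infixr 6 _⊠_

data Type : Set where
  unit bool nat : Type
  maybe list    : Type → Type
  _⊠_           : Type → Type → Type

El : Type → Set
El unit      = ⊤
El bool      = Bool
El nat       = ℕ
El (maybe A) = Maybe (El A)
El (list A)  = List (El A)
El (A ⊠ B)   = El A × El B

-- Values of `nat` are unary, unlike in `encodeℕ`. The tree of a number is thus the tree of a list
-- of units, so loops over numbers are folds over lists. Binary numerals of the input have type
-- `list bool` instead.
encode : ∀ A → El A → Data
encode unit      _       = nil
encode bool      b       = encodeBool b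
encode nat       zero    = nil
encode nat       (suc n) = cons nil (encode nat n)
encode (maybe A) x       = encodeMaybe (encode A) x
encode (list A)  xs      = encodeList (encode A) xs
encode (A ⊠ B)   (x , y) = cons (encode A x) (encode B y)

sizeOf : ∀ A → El A → ℕ
sizeOf A x = size (encode A x)

size≥1 : ∀ d → 1 ≤ size d
size≥1 nil        = ≤-refl
size≥1 (cons d e) = s≤s z≤n

-- Polynomial-time functions

Runs : Cmd 2 → Store 2 → Store 2 → ℕ → Set
Runs c σ τ T = Σ[ t ∈ ℕ ] ⟨ c , σ ⟩⇓[ t ] τ × t ≤ T

infixr 5 _⨟_

_⨟_ : ∀ {c d σ τ υ S T} → Runs c σ τ S → Runs d τ υ T → Runs (c ⨾ d) σ υ (S + T)
(s , r , s≤) ⨟ (t , q , t≤) = s + t , seq r q , +-mono-≤ s≤ t≤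

runs : ∀ {c σ t τ} → ⟨ c , σ ⟩⇓[ t ] τ → Runs c σ τ t
runs r = _ , r , ≤-refl

relax : ∀ {c σ τ S T} → S ≤ T → Runs c σ τ S → Runs c σ τ T
relax S≤T (t , r , t≤) = t , r , ≤-trans t≤ S≤T

-- Variable 0 holds the argument and then the value; variable 1 is a stack, which
-- the code must leave as it found it.  This makes codes composable.
record Fun (A B : Type) : Set where
  field
    apply   : El A → El B
    code    : Cmd 2
    time    : Polynomial
    space   : Polynomial
    correct : ∀ x s → Runs code (encode A x ∷ s ∷ []) (encode B (apply x) ∷ s ∷ []) (time ⟨ sizeOf A x ⟩)
    sized   : ∀ x → sizeOf B (apply x) ≤ space ⟨ sizeOf A x ⟩

open Fun

value stack : ∀ {m} → Expr (2 + m)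
value = var zero
stack = var (suc zero)

fromExpr : ∀ {A B} (f : El A → El B) (e : Expr 2) (p : Polynomial) →
           (∀ x s → ⟦ e ⟧ (encode A x ∷ s ∷ []) ≡ encode B (f x)) →
           (∀ x → sizeOf B (f x) ≤ p ⟨ sizeOf A x ⟩) → Fun A B
fromExpr {A} f e p eq small = record
  { apply   = f
  ; code    = zero := e
  ; time    = con (1 + cost e)
  ; space   = p
  ; correct = λ x s → subst (λ d → Runs (zero := e) (encode A x ∷ s ∷ []) (d ∷ s ∷ []) (1 + cost e)) (eq x s) (runs assign)
  ; sized   = small
  }

-- Replaces the function assembled by the combinators with its intended specification, so that later
-- proofs need not see how the program is built.
computes : ∀ {A B} (f : Fun A B) (g : El A → El B) → (∀ x → apply f x ≡ g x) → Fun A B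
computes {A} {B} f g eq = record
  { apply   = g
  ; code    = code f
  ; time    = time f
  ; space   = space f
  ; correct = λ x s → subst (λ y → Runs (code f) (encode A x ∷ s ∷ []) (encode B y ∷ s ∷ []) (time f ⟨ sizeOf A x ⟩))
                            (eq x) (correct f x s)
  ; sized   = λ x → subst (λ y → sizeOf B y ≤ space f ⟨ sizeOf A x ⟩) (eq x) (sized f x)
  }

infixr 9 _∙_

_∙_ : ∀ {A B C} → Fun B C → Fun A B → Fun A C
apply   (g ∙ f) = λ x → apply g (apply f x)
code    (g ∙ f) = code f ⨾ code g
time    (g ∙ f) = time f ⊕ time g ⊙ space f
space   (g ∙ f) = space g ⊙ space f
correct (g ∙ f) x s = correct f x s ⨟ relax (⟨⟩-mono (time g) (sized f x)) (correct g (apply f x) s)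
sized   (g ∙ f) x = ≤-trans (sized g (apply f x)) (⟨⟩-mono (space g) (sized f x))

-- For want of a third variable, `swap` exchanges the value and the top of the stack through a
-- temporary pair.
push drop swap : Cmd 2
push = suc zero := cons value stack
drop = suc zero := tl stack
swap = zero := cons value (hd stack) ⨾ suc zero := cons (hd value) (tl stack) ⨾ zero := tl value

infixr 4 _,′_

_,′_ : ∀ {A B C} → Fun A B → Fun A C → Fun A (B ⊠ C)
apply   (f ,′ g) x = apply f x , apply g x
code    (f ,′ g) = push ⨾ code f ⨾ swap ⨾ code g ⨾ zero := cons (hd stack) value ⨾ drop
-- The constants are the costs of `push`, of `swap` and of the last two assignments.
time    (f ,′ g) = con 4 ⊕ (time f ⊕ (con 14 ⊕ (time g ⊕ con 8)))
space   (f ,′ g) = con 1 ⊕ space f ⊕ space g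
correct (f ,′ g) x s =
  runs assign ⨟ correct f x _ ⨟ (runs assign ⨟ runs assign ⨟ runs assign) ⨟ correct g x _ ⨟ (runs assign ⨟ runs assign)
sized   (f ,′ g) x = s≤s (+-mono-≤ (sized f x) (sized g x))

id′ : ∀ {A} → Fun A A
id′ = fromExpr id value 𝐱 (λ _ _ → refl) (λ _ → ≤-refl)

fst : ∀ {A B} → Fun (A ⊠ B) A
fst {A} {B} = fromExpr proj₁ (hd value) 𝐱 (λ _ _ → refl) (λ (x , y) → m≤n⇒m≤1+n (m≤m+n (sizeOf A x) (sizeOf B y)))

snd : ∀ {A B} → Fun (A ⊠ B) B
snd {A} {B} = fromExpr proj₂ (tl value) 𝐱 (λ _ _ → refl) (λ (x , y) → m≤n⇒m≤1+n (m≤n+m (sizeOf B y) (sizeOf A x)))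

-- The test for nil is the only case distinction available to programs.
record Split (A R : Type) : Set where
  field
    view    : El A → Maybe (El R)
    payload : Expr 2
    matches : ∀ x s → maybe′
      (λ r → ¬ (encode A x ≡ nil) × ⟦ payload ⟧ (encode A x ∷ s ∷ []) ≡ encode R r × sizeOf R r ≤ sizeOf A x)
      (encode A x ≡ nil) (view x)

open Split

branch : ∀ {Γ A R B} → Split A R → Fun Γ A → Fun Γ B → Fun (Γ ⊠ R) B → Fun Γ B
branch {Γ} {A} {R} {B} v m f g = record
  { apply   = λ γ → maybe′ (λ r → apply g (γ , r)) (apply f γ) (view v (apply m γ))
  ; code    = push ⨾ code m ⨾ if value
                               then (zero := cons (hd stack) (payload v) ⨾ drop ⨾ code g)
                               else (zero := hd stack ⨾ drop ⨾ code f)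
  -- The times of both branches are added, which bounds either of them without a maximum.
  ; time    = con 4 ⊕ (time m ⊕ (con 2 ⊕ (onJust ⊕ (con 3 ⊕ (con 3 ⊕ time f)))))
  ; space   = space f ⊕ space g ⊙ arg
  ; correct = λ γ s → runs assign ⨟ correct m γ _ ⨟ test γ s
  ; sized   = bounded
  }
  where
  arg onJust : Polynomial
  arg    = con 1 ⊕ 𝐱 ⊕ space m
  onJust = con (4 + cost (payload v)) ⊕ (con 3 ⊕ time g ⊙ arg)

  arg-bound : ∀ γ {r} → sizeOf R r ≤ sizeOf A (apply m γ) → sizeOf (Γ ⊠ R) (γ , r) ≤ arg ⟨ sizeOf Γ γ ⟩
  arg-bound γ r≤ = s≤s (+-monoʳ-≤ (sizeOf Γ γ) (≤-trans r≤ (sized m γ)))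

  test : ∀ γ s → Runs (if value
                        then (zero := cons (hd stack) (payload v) ⨾ drop ⨾ code g)
                        else (zero := hd stack ⨾ drop ⨾ code f))
                      (encode A (apply m γ) ∷ cons (encode Γ γ) s ∷ [])
                      (encode B (maybe′ (λ r → apply g (γ , r)) (apply f γ) (view v (apply m γ))) ∷ s ∷ []) _
  test γ s with view v (apply m γ) | matches v (apply m γ) (cons (encode Γ γ) s)
  ... | nothing | isNil =
    let t , r , t≤ = runs assign ⨟ runs assign ⨟ correct f γ s
    in _ , if-false isNil r , +-monoʳ-≤ 2 (≤-trans t≤ (m≤n+m _ (onJust ⟨ sizeOf Γ γ ⟩)))
  ... | just x | notNil , eq , x≤ =
    let t , r , t≤ = runs assign ⨟ runs assign ⨟ relax (⟨⟩-mono (time g) (arg-bound γ {x} x≤))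
                       (subst (λ d → Runs (code g) (cons (encode Γ γ) d ∷ s ∷ []) _ _) (sym eq) (correct g (γ , x) s))
    in _ , if-true notNil r , +-monoʳ-≤ 2 (≤-trans t≤ (m≤m+n _ _))

  bounded : ∀ γ → sizeOf B (maybe′ (λ r → apply g (γ , r)) (apply f γ) (view v (apply m γ))) ≤ _
  bounded γ with view v (apply m γ) | matches v (apply m γ) nil
  ... | nothing | _          = ≤-trans (sized f γ) (m≤m+n _ _)
  ... | just x  | _ , _ , x≤ = ≤-trans (sized g (γ , x)) (≤-trans (⟨⟩-mono (space g) (arg-bound γ {x} x≤)) (m≤n+m _ _))

-- Adding at most grow(|γ , x|) to the size of the accumulator in each step keeps
-- it polynomial; a bound on the step that is merely polynomial would not.
foldl′ : ∀ {Γ E A} (step : Fun ((Γ ⊠ E) ⊠ A) A) → Fun Γ A → Fun Γ (list E) → (grow : Polynomial) →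
         (∀ γ x a → sizeOf A (apply step ((γ , x) , a)) ≤ sizeOf A a + grow ⟨ sizeOf (Γ ⊠ E) (γ , x) ⟩) →
         Fun Γ A
foldl′ {Γ} {E} {A} step init elems grow grows = record
  { apply   = λ γ → List.foldl (act γ) (apply init γ) (apply elems γ)
  ; code    = push ⨾ code elems ⨾ load ⨾ code init ⨾ while hd stack loop body ⨾ suc zero := tl (tl stack)
  ; time    = con 4 ⊕ (time elems ⊕ (con 13 ⊕ (time init ⊕ ((space elems ⊗ iteration ⊕ con 3) ⊕ con 4))))
  ; space   = final
  ; correct = λ γ s →
      runs assign ⨟ correct elems γ _ ⨟ (runs assign ⨟ runs assign ⨟ runs assign) ⨟ correct init γ _ ⨟
      relax (+-monoˡ-≤ 3 (*-monoˡ-≤ _ (≤-trans (length≤size (apply elems γ)) (sized elems γ))))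
        (iterate γ s (apply elems γ) (apply init γ) (sized elems γ) (start γ)) ⨟ runs assign
  ; sized   = λ γ → final-bound γ (apply elems γ) (apply init γ) (sized elems γ) (start γ)
  }
  where
  act : El Γ → El A → El E → El A
  act γ a x = apply step ((γ , x) , a)

  load body : Cmd 2
  load = zero := cons value (hd stack) ⨾ suc zero := cons (hd value) stack ⨾ zero := tl value
  body  = zero := cons (cons (hd (tl stack)) (hd (hd stack))) value ⨾
          suc zero := cons (tl (hd stack)) (tl stack) ⨾
          code step

  growth final iteration : Polynomial
  growth    = grow ⊙ (con 1 ⊕ 𝐱 ⊕ space elems)
  final     = space init ⊕ space elems ⊗ growth
  -- The loop test costs 3, the two assignments before `code step` cost 10 and 7. The argument of
  -- `step` consists of the context, an element and the accumulator, which `final` bounds.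
  iteration = con 20 ⊕ time step ⊙ (con 1 ⊕ (con 1 ⊕ 𝐱 ⊕ space elems) ⊕ final)

  length≤size : ∀ xs → length xs ≤ sizeOf (list E) xs
  length≤size []       = z≤n
  length≤size (x ∷ xs) = s≤s (≤-trans (length≤size xs) (m≤n+m _ _))

  start : ∀ γ → sizeOf A (apply init γ) + length (apply elems γ) * growth ⟨ sizeOf Γ γ ⟩ ≤ final ⟨ sizeOf Γ γ ⟩
  start γ = +-mono-≤ (sized init γ)
                     (*-monoˡ-≤ (growth ⟨ sizeOf Γ γ ⟩) (≤-trans (length≤size (apply elems γ)) (sized elems γ)))

  module _ (γ : El Γ) where
    n : ℕ
    n = sizeOf Γ γ

    head≤ : ∀ x xs → sizeOf (list E) (x ∷ xs) ≤ space elems ⟨ n ⟩ → sizeOf E x ≤ space elems ⟨ n ⟩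
    head≤ x xs = ≤-trans (m≤n⇒m≤1+n (m≤m+n _ _))

    tail≤ : ∀ x xs → sizeOf (list E) (x ∷ xs) ≤ space elems ⟨ n ⟩ → sizeOf (list E) xs ≤ space elems ⟨ n ⟩
    tail≤ x xs = ≤-trans (m≤n⇒m≤1+n (m≤n+m _ _))

    -- The size of the accumulator plus one `growth` for each remaining element acts as a potential:
    -- a step spends at most the share of the element that it consumes.
    invariant : ∀ x xs a → sizeOf (list E) (x ∷ xs) ≤ space elems ⟨ n ⟩ →
                sizeOf A a + length (x ∷ xs) * growth ⟨ n ⟩ ≤ final ⟨ n ⟩ →
                sizeOf A (act γ a x) + length xs * growth ⟨ n ⟩ ≤ final ⟨ n ⟩
    invariant x xs a xs≤ a≤ = begin
      sizeOf A (act γ a x) + length xs * growth ⟨ n ⟩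
        ≤⟨ +-monoˡ-≤ _ (≤-trans (grows γ x a) (+-monoʳ-≤ (sizeOf A a)
             (⟨⟩-mono grow (s≤s (+-monoʳ-≤ n (head≤ x xs xs≤)))))) ⟩
      sizeOf A a + growth ⟨ n ⟩ + length xs * growth ⟨ n ⟩
        ≡⟨ +-assoc (sizeOf A a) _ _ ⟩
      sizeOf A a + length (x ∷ xs) * growth ⟨ n ⟩
        ≤⟨ a≤ ⟩
      final ⟨ n ⟩ ∎
      where open ≤-Reasoning

    final-bound : ∀ xs a → sizeOf (list E) xs ≤ space elems ⟨ n ⟩ →
                  sizeOf A a + length xs * growth ⟨ n ⟩ ≤ final ⟨ n ⟩ →
                  sizeOf A (List.foldl (act γ) a xs) ≤ final ⟨ n ⟩
    final-bound []       a xs≤ a≤ = ≤-trans (m≤m+n _ _) a≤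
    final-bound (x ∷ xs) a xs≤ a≤ = final-bound xs (act γ a x) (tail≤ x xs xs≤) (invariant x xs a xs≤ a≤)

    iterate : ∀ s xs a → sizeOf (list E) xs ≤ space elems ⟨ n ⟩ →
           sizeOf A a + length xs * growth ⟨ n ⟩ ≤ final ⟨ n ⟩ →
           Runs (while hd stack loop body)
                (encode A a ∷ cons (encode (list E) xs) (cons (encode Γ γ) s) ∷ [])
                (encode A (List.foldl (act γ) a xs) ∷ cons nil (cons (encode Γ γ) s) ∷ [])
                (length xs * iteration ⟨ n ⟩ + 3)
    iterate s []       a xs≤ a≤ = runs (while-false refl)
    iterate s (x ∷ xs) a xs≤ a≤ =
      let arg≤ = s≤s (+-mono-≤ (s≤s (+-monoʳ-≤ n (head≤ x xs xs≤))) (≤-trans (m≤m+n _ _) a≤))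
          t , r , t≤ = runs assign ⨟ runs assign ⨟ relax (⟨⟩-mono (time step) arg≤) (correct step ((γ , x) , a) _)
          t′ , r′ , t′≤ = iterate s xs (act γ a x) (tail≤ x xs xs≤) (invariant x xs a xs≤ a≤)
      in _ , while-true (λ ()) r r′ ,
         ≤-trans (+-mono-≤ (+-monoʳ-≤ 3 t≤) t′≤) (≤-reflexive (sym (+-assoc _ (length xs * iteration ⟨ n ⟩) 3)))

-- Basic functions on the encodable types

boolSplit : Split bool unit
boolSplit = record
  { view    = λ b → when b then just tt else nothing
  ; payload = nil
  ; matches = λ { false s → refl ; true s → (λ ()) , refl , s≤s z≤n }
  }

natSplit : Split nat nat
natSplit = record
  { view    = λ { zero → nothing ; (suc n) → just n }
  ; payload = tl value
  ; matches = λ { zero s → refl ; (suc n) s → (λ ()) , refl , m≤n+m _ 2 }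
  }

maybeSplit : ∀ {A} → Split (maybe A) A
maybeSplit = record
  { view    = id
  ; payload = tl value
  ; matches = λ { nothing s → refl ; (just x) s → (λ ()) , refl , m≤n+m _ 2 }
  }

listSplit : ∀ {A} → Split (list A) (A ⊠ list A)
listSplit = record
  { view    = λ { [] → nothing ; (x ∷ xs) → just (x , xs) }
  ; payload = value
  ; matches = λ { [] s → refl ; (x ∷ xs) s → (λ ()) , refl , ≤-refl }
  }

true′ false′ : ∀ {Γ} → Fun Γ bool
true′  = fromExpr (λ _ → true) (cons nil nil) (con 3) (λ _ _ → refl) (λ _ → ≤-refl)
false′ = fromExpr (λ _ → false) nil (con 1) (λ _ _ → refl) (λ _ → ≤-refl)

zero′ : ∀ {Γ} → Fun Γ nat
zero′ = fromExpr (λ _ → zero) nil (con 1) (λ _ _ → refl) (λ _ → ≤-refl)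

suc′ : Fun nat nat
suc′ = fromExpr suc (cons nil value) (con 2 ⊕ 𝐱) (λ _ _ → refl) (λ _ → ≤-refl)

sizeOf-pred : ∀ n → sizeOf nat (pred n) ≤ sizeOf nat n
sizeOf-pred zero    = ≤-refl
sizeOf-pred (suc n) = m≤n+m _ 2

pred′ : Fun nat nat
pred′ = fromExpr pred (tl value) 𝐱 (λ { zero _ → refl ; (suc _) _ → refl }) sizeOf-pred

nil′ : ∀ {Γ A} → Fun Γ (list A)
nil′ = fromExpr (λ _ → []) nil (con 1) (λ _ _ → refl) (λ _ → ≤-refl)

cons′ : ∀ {A} → Fun (A ⊠ list A) (list A)
cons′ = fromExpr (λ (x , xs) → x ∷ xs) value 𝐱 (λ _ _ → refl) (λ _ → ≤-refl)

tail′ : {A : Set} → List A → List A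
tail′ = List.drop 1

sizeOf-tail : ∀ {A} xs → sizeOf (list A) (tail′ xs) ≤ sizeOf (list A) xs
sizeOf-tail []       = ≤-refl
sizeOf-tail {A} (x ∷ xs) = m≤n+m _ (suc (sizeOf A x))

rest : ∀ {A} → Fun (list A) (list A)
rest {A} = fromExpr tail′ (tl value) 𝐱 (λ { [] _ → refl ; (_ ∷ _) _ → refl }) (sizeOf-tail {A})

infixr 4 let′_in′_
infixr 5 if′_then_else_
infixr 6 _∧′_

let′_in′_ : ∀ {Γ A B} → Fun Γ A → Fun (Γ ⊠ A) B → Fun Γ B
let′ f in′ g = g ∙ (id′ ,′ f)

if′_then_else_ : ∀ {Γ A} → Fun Γ bool → Fun Γ A → Fun Γ A → Fun Γ A
if′_then_else_ {Γ} b f g = computes (branch boolSplit b g (f ∙ fst))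
  (λ γ → when apply b γ then apply f γ else apply g γ) lemma
  where
  lemma : ∀ γ → maybe′ (λ _ → apply f γ) (apply g γ) (when apply b γ then just tt else nothing) ≡
                (when apply b γ then apply f γ else apply g γ)
  lemma γ with apply b γ
  ... | true  = refl
  ... | false = refl

_∧′_ : ∀ {Γ} → Fun Γ bool → Fun Γ bool → Fun Γ bool
f ∧′ g = computes (if′ f then g else false′) (λ γ → apply f γ ∧ apply g γ) lemma
  where
  lemma : ∀ γ → (when apply f γ then apply g γ else false) ≡ apply f γ ∧ apply g γ
  lemma γ with apply f γ
  ... | true  = refl
  ... | false = refl

-- Iteration over lists and numbers

reverse′ : ∀ {A} → Fun (list A) (list A)
reverse′ {A} = foldl′ (cons′ ∙ (snd ∙ fst ,′ snd)) nil′ id′ 𝐱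
  λ γ x a → ≤-trans (≤-reflexive (+-comm (suc (sizeOf A x)) _)) (+-monoʳ-≤ (sizeOf (list A) a) (s≤s (m≤n+m _ _)))

map′ : ∀ {Γ A B} → Fun (Γ ⊠ A) B → Fun Γ (list A) → Fun Γ (list B)
map′ {Γ} {A} {B} f xs = computes
  -- A left fold that conses reverses its list, so the list is reversed beforehand.
  (foldl′ (cons′ ∙ (f ∙ fst ,′ snd)) nil′ (reverse′ ∙ xs) (con 1 ⊕ space f)
    λ γ x a → ≤-trans (≤-reflexive (+-comm (suc (sizeOf B (apply f (γ , x)))) _))
                      (+-monoʳ-≤ (sizeOf (list B) a) (s≤s (sized f (γ , x)))))
  (λ γ → List.map (λ x → apply f (γ , x)) (apply xs γ))
  λ γ → trans (reverse-foldl _ [] (apply xs γ)) (sym (map-is-foldr (apply xs γ)))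

count′ : ∀ {Γ A} → Fun (Γ ⊠ A) bool → Fun Γ (list A) → Fun Γ nat
count′ {Γ} {A} p xs = computes
  (foldl′ (if′ p ∙ fst then suc′ ∙ snd else snd) zero′ xs (con 2) grows)
  (λ γ → length (filterᵇ (λ x → apply p (γ , x)) (apply xs γ)))
  (λ γ → trans (count-acc γ (apply xs γ) 0) (+-identityʳ _))
  where
  grows : ∀ γ x n → sizeOf nat (when apply p (γ , x) then suc n else n) ≤ sizeOf nat n + 2
  grows γ x n with apply p (γ , x)
  ... | true  = ≤-reflexive (+-comm 2 _)
  ... | false = m≤m+n _ 2

  count-acc : ∀ γ xs n → List.foldl (λ n x → when apply p (γ , x) then suc n else n) n xs ≡
                         length (filterᵇ (λ x → apply p (γ , x)) xs) + n
  count-acc γ []       n = refl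
  count-acc γ (x ∷ xs) n with apply p (γ , x)
  ... | true  = trans (count-acc γ xs (suc n)) (+-suc _ n)
  ... | false = count-acc γ xs n

-- The accumulator holds the unread part of the second list and the pairs built so far, in reverse.
-- An entry `y` only moves from the former to the latter, so what a step adds is paid for by `x`.
zip′ : ∀ {Γ A B} → Fun Γ (list A) → Fun Γ (list B) → Fun Γ (list (A ⊠ B))
zip′ {Γ} {A} {B} xs ys = computes
  (reverse′ ∙ snd ∙ foldl′ step (ys ,′ nil′) xs (con 2 ⊕ 𝐱) grows)
  (λ γ → zip (apply xs γ) (apply ys γ))
  (λ γ → trans (cong List.reverse (zip-acc γ (apply xs γ) (apply ys γ) [])) (reverse-involutive _))
  where
  step : Fun ((Γ ⊠ A) ⊠ list B ⊠ list (A ⊠ B)) (list B ⊠ list (A ⊠ B))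
  step = branch listSplit (fst ∙ snd) snd
           (snd ∙ snd ,′ cons′ ∙ ((snd ∙ fst ∙ fst ,′ fst ∙ snd) ,′ snd ∙ snd ∙ fst))

  grows : ∀ γ x a → sizeOf (list B ⊠ list (A ⊠ B)) (apply step ((γ , x) , a)) ≤
                    sizeOf (list B ⊠ list (A ⊠ B)) a + (2 + sizeOf (Γ ⊠ A) (γ , x))
  grows γ x ([] , zs)     = m≤m+n _ _
  grows γ x (y ∷ ys , zs) = begin
    suc (|ys| + suc (suc (|x| + |y|) + |zs|))           ≡⟨ rearrange |x| |y| |ys| |zs| ⟩
    suc (suc (|y| + |ys|) + |zs|) + (1 + |x|)           ≤⟨ +-monoʳ-≤ (suc (suc (|y| + |ys|) + |zs|))
                                                                     (s≤s (m≤n+m _ (2 + sizeOf Γ γ))) ⟩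
    suc (suc (|y| + |ys|) + |zs|) + (2 + suc (sizeOf Γ γ + |x|)) ∎
    where
    open ≤-Reasoning
    |x| |y| |ys| |zs| : ℕ
    |x| = sizeOf A x
    |y| = sizeOf B y
    |ys| = sizeOf (list B) ys
    |zs| = sizeOf (list (A ⊠ B)) zs
    rearrange : ∀ x y ys zs → suc (ys + suc (suc (x + y) + zs)) ≡ suc (suc (y + ys) + zs) + (1 + x)
    rearrange = solve-∀

  zip-acc : ∀ γ xs ys zs → proj₂ (List.foldl (λ a x → apply step ((γ , x) , a)) (ys , zs) xs) ≡
                           List.foldl (λ zs z → z ∷ zs) zs (zip xs ys)
  zip-acc γ []       ys       zs = refl
  zip-acc γ (x ∷ xs) []       zs = trans (zip-acc γ xs [] zs) (cong (List.foldl _ zs) (zip-[] xs))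
    where
    zip-[] : ∀ {A B : Set} (xs : List A) → zip {B = B} xs [] ≡ []
    zip-[] []       = refl
    zip-[] (x ∷ xs) = refl
  zip-acc γ (x ∷ xs) (y ∷ ys) zs = zip-acc γ xs ys ((x , y) ∷ zs)

spine : Fun nat (list unit)
spine = fromExpr (λ n → replicate n tt) value 𝐱 (λ n s → same n) (λ n → ≤-reflexive (cong size (sym (same n))))
  where
  same : ∀ n → encode nat n ≡ encode (list unit) (replicate n tt)
  same zero    = refl
  same (suc n) = cong (cons nil) (same n)

iterate′ : ∀ {Γ A} (step : Fun A A) → Fun Γ A → Fun Γ nat → (g : ℕ) →
           (∀ a → sizeOf A (apply step a) ≤ sizeOf A a + g) → Fun Γ A
iterate′ {Γ} {A} step init n g grows = computes
  (foldl′ (step ∙ snd) init (spine ∙ n) (con g) (λ _ _ → grows))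
  (λ γ → fold (apply init γ) (apply step) (apply n γ))
  (λ γ → foldl-fold (apply init γ) (apply n γ))
  where
  foldl-step : ∀ a (xs : List ⊤) → List.foldl (λ a _ → apply step a) (apply step a) xs ≡
                                   apply step (List.foldl (λ a _ → apply step a) a xs)
  foldl-step a []       = refl
  foldl-step a (x ∷ xs) = foldl-step (apply step a) xs

  foldl-fold : ∀ a n → List.foldl (λ a _ → apply step a) a (replicate n tt) ≡ fold a (apply step) n
  foldl-fold a zero    = refl
  foldl-fold a (suc n) = trans (foldl-step a (replicate n tt)) (cong (apply step) (foldl-fold a n))

-- Unary arithmetic

infixl 8 _+′_ _∸′_
infix  7 _≤ᵇ′_

_+′_ : ∀ {Γ} → Fun Γ nat → Fun Γ nat → Fun Γ nat
f +′ g = computes (iterate′ suc′ g f 2 (λ _ → ≤-reflexive (+-comm 2 _))) (λ γ → apply f γ + apply g γ)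
                  (λ γ → lemma (apply f γ) (apply g γ))
  where
  lemma : ∀ m n → fold n suc m ≡ m + n
  lemma zero    n = refl
  lemma (suc m) n = cong suc (lemma m n)

_∸′_ : ∀ {Γ} → Fun Γ nat → Fun Γ nat → Fun Γ nat
f ∸′ g = computes (iterate′ pred′ f g 0 (λ n → ≤-trans (sizeOf-pred n) (m≤m+n _ 0))) (λ γ → apply f γ ∸ apply g γ)
                  (λ γ → lemma (apply f γ) (apply g γ))
  where
  lemma : ∀ m n → fold m pred n ≡ m ∸ n
  lemma m zero    = refl
  lemma m (suc n) = trans (cong pred (lemma m n)) (pred[m∸n]≡m∸[1+n] m n)

≤ᵇ-suc : ∀ m n → (suc m ≤ᵇ suc n) ≡ (m ≤ᵇ n)
≤ᵇ-suc zero    n = refl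
≤ᵇ-suc (suc m) n = refl

_≤ᵇ′_ : ∀ {Γ} → Fun Γ nat → Fun Γ nat → Fun Γ bool
f ≤ᵇ′ g = computes (branch natSplit (f ∸′ g) true′ false′) (λ γ → apply f γ ≤ᵇ apply g γ)
                   (λ γ → lemma (apply f γ) (apply g γ))
  where
  lemma : ∀ m n → maybe′ (λ _ → false) true (view natSplit (m ∸ n)) ≡ (m ≤ᵇ n)
  lemma zero    zero    = refl
  lemma zero    (suc n) = refl
  lemma (suc m) zero    = refl
  lemma (suc m) (suc n) = trans (lemma m n) (sym (≤ᵇ-suc m n))

odd : ℕ → Bool
odd 0             = false
odd 1             = true
odd (suc (suc n)) = odd n

odd-suc : ∀ n → odd (suc n) ≡ not (odd n)
odd-suc 0             = refl
odd-suc 1             = refl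
odd-suc (suc (suc n)) = odd-suc n

⌊1+n/2⌋ : ∀ n → ⌊ suc n /2⌋ ≡ (when odd n then suc ⌊ n /2⌋ else ⌊ n /2⌋)
⌊1+n/2⌋ 0             = refl
⌊1+n/2⌋ 1             = refl
⌊1+n/2⌋ (suc (suc n)) rewrite ⌊1+n/2⌋ n with odd n
... | true  = refl
... | false = refl

divMod2 : ∀ {Γ} → Fun Γ nat → Fun Γ (bool ⊠ nat)
divMod2 f = computes (iterate′ step (false′ ,′ zero′) f 4 grows) (λ γ → odd (apply f γ) , ⌊ apply f γ /2⌋)
                     (λ γ → lemma (apply f γ))
  where
  step : Fun (bool ⊠ nat) (bool ⊠ nat)
  step = if′ fst then (false′ ,′ suc′ ∙ snd) else (true′ ,′ snd)

  grows : ∀ a → sizeOf (bool ⊠ nat) (apply step a) ≤ sizeOf (bool ⊠ nat) a + 4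
  grows (true , n)  = ≤-trans (m≤n+m _ 4) (≤-reflexive (+-comm 4 _))
  grows (false , n) = ≤-trans (m≤n+m _ 2) (≤-reflexive (+-comm 4 _))

  lemma : ∀ n → fold (false , 0) (apply step) n ≡ (odd n , ⌊ n /2⌋)
  lemma zero = refl
  lemma (suc n) rewrite lemma n | odd-suc n | ⌊1+n/2⌋ n with odd n
  ... | true  = refl
  ... | false = refl

-- Comparing p D with q S, for p and q in binary and D and S in unary

-- Bijective base 2, least significant digit first, as in encodeℕᵇ.
Bits : Set
Bits = List Bool

bits : Type
bits = list bool

lowDigit : Bits → ℕ
lowDigit []          = 0
lowDigit (false ∷ _) = 1
lowDigit (true ∷ _)  = 2

⟦_⟧₂ : Bits → ℕ
⟦ [] ⟧₂     = 0
⟦ b ∷ bs ⟧₂ = lowDigit (b ∷ bs) + 2 * ⟦ bs ⟧₂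

⟦⟧₂-split : ∀ bs → ⟦ bs ⟧₂ ≡ lowDigit bs + 2 * ⟦ tail′ bs ⟧₂
⟦⟧₂-split []       = refl
⟦⟧₂-split (b ∷ bs) = refl

-- A digit is at most 2, so multiplying by it takes at most one addition.
scale : ∀ {Γ} → Fun Γ bits → Fun Γ nat → Fun Γ nat
scale bs n = computes (branch listSplit bs zero′ (if′ fst ∙ snd then n ∙ fst +′ n ∙ fst else n ∙ fst))
  (λ γ → lowDigit (apply bs γ) * apply n γ) (λ γ → lemma γ (apply bs γ))
  where
  lemma : ∀ γ bs → maybe′ (λ r → when proj₁ r then apply n γ + apply n γ else apply n γ) 0
                          (view (listSplit {bool}) bs) ≡
                   lowDigit bs * apply n γ
  lemma γ []          = refl
  lemma γ (false ∷ _) = sym (+-identityʳ _)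
  lemma γ (true ∷ _)  = cong (λ m → apply n γ + m) (sym (+-identityʳ _))

-- The state ((p , q) , (a , b)) stands for p D + a ≤ q S + b.  The lowest digits are
-- absorbed into the carries, which are then halved:
-- 2 X + M ≤ 2 Y + N  iff  X + ⌊ (M + e) / 2 ⌋ ≤ Y + ⌊ N / 2 ⌋, with e ∈ {0,1} making N + e odd.

Carries : Set
Carries = (Bits × Bits) × (ℕ × ℕ)

carry : ℕ × ℕ → ℕ × ℕ
carry (M , N) = ⌊ (when odd N then M else suc M) /2⌋ , ⌊ N /2⌋

advance : ℕ → ℕ → Carries → Carries
advance D S ((p , q) , (a , b)) = (tail′ p , tail′ q) , carry (lowDigit p * D + a , lowDigit q * S + b)

holds : ℕ → ℕ → Carries → Bool
holds D S ((p , q) , (a , b)) = ⟦ p ⟧₂ * D + a ≤ᵇ ⟦ q ⟧₂ * S + b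

-- If N = 2t + 1, then M ≤ N iff ⌊M / 2⌋ ≤ t. If N = 2t, then M ≤ N iff M + 1 ≤ 2t + 1, that is, ⌊(M
-- + 1) / 2⌋ ≤ t. The induction removes 2 from both sides.
≤ᵇ-carry : ∀ M N → (M ≤ᵇ N) ≡ (proj₁ (carry (M , N)) ≤ᵇ ⌊ N /2⌋)
≤ᵇ-carry 0             0 = refl
≤ᵇ-carry 1             0 = refl
≤ᵇ-carry (suc (suc M)) 0 = refl
≤ᵇ-carry 0             1 = refl
≤ᵇ-carry 1             1 = refl
≤ᵇ-carry (suc (suc M)) 1 = refl
≤ᵇ-carry 0 (suc (suc N)) with odd N
... | true  = refl
... | false = refl
≤ᵇ-carry 1 (suc (suc N)) with odd N
... | true  = refl
... | false = refl
≤ᵇ-carry (suc (suc M)) (suc (suc N)) with odd N | ≤ᵇ-carry M N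
... | true  | eq = trans (≤ᵇ-suc (suc M) (suc N)) (trans (≤ᵇ-suc M N) (trans eq (sym (≤ᵇ-suc ⌊ M /2⌋ _))))
... | false | eq = trans (≤ᵇ-suc (suc M) (suc N)) (trans (≤ᵇ-suc M N) (trans eq (sym (≤ᵇ-suc ⌊ suc M /2⌋ _))))

double+ : ∀ X M → suc X + suc X + M ≡ suc (suc (X + X + M))
double+ X M = cong (λ n → suc (n + M)) (+-suc X X)

⌊double+⌋ : ∀ X M → ⌊ X + X + M /2⌋ ≡ X + ⌊ M /2⌋
⌊double+⌋ zero    M = refl
⌊double+⌋ (suc X) M = trans (cong ⌊_/2⌋ (double+ X M)) (cong suc (⌊double+⌋ X M))

odd-double+ : ∀ X M → odd (X + X + M) ≡ odd M
odd-double+ zero    M = refl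
odd-double+ (suc X) M = trans (cong odd (double+ X M)) (odd-double+ X M)

carry-double+ : ∀ X Y M N → proj₁ (carry (X + X + M , Y + Y + N)) ≡ X + proj₁ (carry (M , N))
carry-double+ X Y M N rewrite odd-double+ Y N with odd N
... | true  = ⌊double+⌋ X M
... | false = trans (cong ⌊_/2⌋ (sym (+-suc (X + X) M))) (⌊double+⌋ X (suc M))

-- Once the lowest digits are split off, the remaining digits contribute the even numbers `X + X`
-- and `Y + Y`. These leave the parity that decides the rounding unchanged and come out of the
-- halving as `X` and `Y`.
holds-advance : ∀ D S s → holds D S (advance D S s) ≡ holds D S s
holds-advance D S ((p , q) , (a , b)) = sym (begin
  (⟦ p ⟧₂ * D + a ≤ᵇ ⟦ q ⟧₂ * S + b)
    ≡⟨ cong₂ _≤ᵇ_ (split p D a) (split q S b) ⟩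
  (X + X + M ≤ᵇ Y + Y + N)
    ≡⟨ ≤ᵇ-carry (X + X + M) (Y + Y + N) ⟩
  (proj₁ (carry (X + X + M , Y + Y + N)) ≤ᵇ ⌊ Y + Y + N /2⌋)
    ≡⟨ cong₂ _≤ᵇ_ (carry-double+ X Y M N) (⌊double+⌋ Y N) ⟩
  (X + proj₁ (carry (M , N)) ≤ᵇ Y + ⌊ N /2⌋) ∎)
  where
  open ≡-Reasoning
  X Y M N : ℕ
  X = ⟦ tail′ p ⟧₂ * D
  Y = ⟦ tail′ q ⟧₂ * S
  M = lowDigit p * D + a
  N = lowDigit q * S + b

  split : ∀ bs n c → ⟦ bs ⟧₂ * n + c ≡ ⟦ tail′ bs ⟧₂ * n + ⟦ tail′ bs ⟧₂ * n + (lowDigit bs * n + c)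
  split bs n c rewrite ⟦⟧₂-split bs = distrib (lowDigit bs) ⟦ tail′ bs ⟧₂ n c
    where
    distrib : ∀ d v n c → (d + 2 * v) * n + c ≡ v * n + v * n + (d * n + c)
    distrib = solve-∀

run : ℕ → ℕ → Carries → Bits → Carries
run D S = List.foldl (λ s _ → advance D S s)

holds-run : ∀ D S s fuel → holds D S (run D S s fuel) ≡ holds D S s
holds-run D S s []         = refl
holds-run D S s (_ ∷ fuel) = trans (holds-run D S (advance D S s) fuel) (holds-advance D S s)

run-exhausts : ∀ D S p q ab fuel → length p ≤ length fuel → length q ≤ length fuel →
               proj₁ (run D S ((p , q) , ab) fuel) ≡ ([] , [])
run-exhausts D S []      []      ab []         p≤ q≤ = refl
run-exhausts D S p       q       ab (_ ∷ fuel) p≤ q≤ =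
  run-exhausts D S (tail′ p) (tail′ q) _ fuel (length-tail p p≤) (length-tail q q≤)
  where
  length-tail : ∀ bs {n} → length bs ≤ suc n → length (tail′ bs) ≤ n
  length-tail []       _         = z≤n
  length-tail (b ∷ bs) (s≤s bs≤) = bs≤

-- The digits of `p` and then of `q` serve as fuel: together they suffice to exhaust both numerals.
-- Afterwards `holds` compares the bare carries, and by its invariance this is the original
-- comparison; rounds beyond exhaustion are harmless.
compare-correct : ∀ D S p q → let ab = proj₂ (run D S (run D S ((p , q) , (0 , 0)) p) q) in
                  (proj₁ ab ≤ᵇ proj₂ ab) ≡ (⟦ p ⟧₂ * D ≤ᵇ ⟦ q ⟧₂ * S)
compare-correct D S p q = begin
  (proj₁ (proj₂ end) ≤ᵇ proj₂ (proj₂ end))  ≡⟨ cong (λ pq → holds D S (pq , proj₂ end)) exhausted ⟨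
  holds D S end                             ≡⟨ holds-run D S _ q ⟩
  holds D S (run D S _ p)                   ≡⟨ holds-run D S _ p ⟩
  (⟦ p ⟧₂ * D + 0 ≤ᵇ ⟦ q ⟧₂ * S + 0)        ≡⟨ cong₂ _≤ᵇ_ (+-identityʳ (⟦ p ⟧₂ * D)) (+-identityʳ (⟦ q ⟧₂ * S)) ⟩
  (⟦ p ⟧₂ * D ≤ᵇ ⟦ q ⟧₂ * S)                ∎
  where
  open ≡-Reasoning
  start end : Carries
  start = (p , q) , (0 , 0)
  end = run D S (run D S start p) q

  exhausted : proj₁ end ≡ ([] , [])
  exhausted = trans (cong proj₁ (sym (foldl-++ (λ s _ → advance D S s) start p q)))
    (run-exhausts D S p q _ (p ++ q)
      (≤-trans (m≤m+n _ _) (≤-reflexive (sym (length-++ p))))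
      (≤-trans (m≤n+m _ _) (≤-reflexive (sym (length-++ p)))))

-- Size of the carries, and the comparison as a polynomial-time function

sizeOf-+ : ∀ m n → sizeOf nat (m + n) ≤ sizeOf nat m + sizeOf nat n
sizeOf-+ zero    n = n≤1+n _
sizeOf-+ (suc m) n = s≤s (s≤s (sizeOf-+ m n))

sizeOf-⌊/2⌋ : ∀ n → sizeOf nat ⌊ n /2⌋ ≤ sizeOf nat n
sizeOf-⌊/2⌋ 0             = ≤-refl
sizeOf-⌊/2⌋ 1             = s≤s z≤n
sizeOf-⌊/2⌋ (suc (suc n)) = s≤s (s≤s (m≤n⇒m≤1+n (m≤n⇒m≤1+n (sizeOf-⌊/2⌋ n))))

sizeOf-lowDigit* : ∀ bs n → sizeOf nat (lowDigit bs * n) ≤ sizeOf nat n + sizeOf nat n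
sizeOf-lowDigit* []          n = ≤-trans (size≥1 (encode nat n)) (m≤m+n _ _)
sizeOf-lowDigit* (false ∷ _) n = ≤-trans (≤-reflexive (cong (sizeOf nat) (+-identityʳ n))) (m≤m+n _ _)
sizeOf-lowDigit* (true ∷ _)  n = ≤-trans (≤-reflexive (cong (λ m → sizeOf nat (n + m)) (+-identityʳ n))) (sizeOf-+ n n)

sizeOf-carry : ∀ M N → sizeOf nat (proj₁ (carry (M , N))) ≤ 2 + sizeOf nat M
sizeOf-carry M N with odd N
... | true  = ≤-trans (sizeOf-⌊/2⌋ M) (m≤n+m _ 2)
... | false = sizeOf-⌊/2⌋ (suc M)

scaledPair : Type
scaledPair = (bits ⊠ nat) ⊠ (bits ⊠ nat)

compareStep : Fun ((scaledPair ⊠ bool) ⊠ (bits ⊠ bits) ⊠ (nat ⊠ nat)) ((bits ⊠ bits) ⊠ (nat ⊠ nat))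
compareStep = computes
  ((rest ∙ fst ∙ fst ∙ snd ,′ rest ∙ snd ∙ fst ∙ snd) ,′
   (let′ scale (fst ∙ fst ∙ snd) (snd ∙ fst ∙ fst ∙ fst) +′ fst ∙ snd ∙ snd in′
    let′ divMod2 (scale (snd ∙ fst ∙ snd) (snd ∙ snd ∙ fst ∙ fst) +′ snd ∙ snd ∙ snd) ∙ fst in′
    (snd ∙ divMod2 (if′ fst ∙ snd then snd ∙ fst else suc′ ∙ snd ∙ fst) ,′ snd ∙ snd)))
  (λ ((((_ , D) , (_ , S)) , _) , s) → advance D S s)
  (λ _ → refl)

-- Even without credit for the halving, a digit adds at most two copies of `D` or `S` to its carry.
-- `D` and `S` belong to the context, so the growth does not depend on the accumulator.
compareStep-grows : ∀ γ x a → sizeOf ((bits ⊠ bits) ⊠ (nat ⊠ nat)) (apply compareStep ((γ , x) , a)) ≤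
  sizeOf ((bits ⊠ bits) ⊠ (nat ⊠ nat)) a + (2 + 2 * sizeOf (scaledPair ⊠ bool) (γ , x))
compareStep-grows ((p₀ , D) , (q₀ , S)) x ((p , q) , (a , b)) = ≤-trans
  (s≤s (+-mono-≤ (s≤s (+-mono-≤ (sizeOf-tail {bool} p) (sizeOf-tail {bool} q)))
                 (s≤s (+-mono-≤
                   (≤-trans (sizeOf-carry (lowDigit p * D + a) (lowDigit q * S + b))
                            (+-monoʳ-≤ 2 (scaled p D a)))
                   (≤-trans (sizeOf-⌊/2⌋ (lowDigit q * S + b)) (scaled q S b))))))
  (≤-trans (m≤m+n _ _) (≤-reflexive (rearrange
    (sizeOf bits p) (sizeOf bits q) (sizeOf nat a) (sizeOf nat b)
    (sizeOf nat D) (sizeOf nat S) (sizeOf bits p₀) (sizeOf bits q₀) (sizeOf bool x))))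
  where
  scaled : ∀ bs n c → sizeOf nat (lowDigit bs * n + c) ≤ sizeOf nat n + sizeOf nat n + sizeOf nat c
  scaled bs n c = ≤-trans (sizeOf-+ (lowDigit bs * n) c) (+-monoˡ-≤ (sizeOf nat c) (sizeOf-lowDigit* bs n))

  rearrange : ∀ p q a b d s p₀ q₀ x →
    suc (suc (p + q) + suc ((2 + (d + d + a)) + (s + s + b))) + (8 + (p₀ + p₀ + q₀ + q₀ + x + x)) ≡
    suc (suc (p + q) + suc (a + b)) + (2 + 2 * suc (suc (suc (p₀ + d) + suc (q₀ + s)) + x))
  rearrange = solve-∀

infix 7 _*_≤ᵇ′_*_

_*_≤ᵇ′_*_ : ∀ {Γ} → Fun Γ bits → Fun Γ nat → Fun Γ bits → Fun Γ nat → Fun Γ bool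
p * D ≤ᵇ′ q * S = computes
  ((fst ∙ snd ≤ᵇ′ snd ∙ snd) ∙
    foldl′ compareStep
      (foldl′ compareStep ((fst ∙ fst ,′ fst ∙ snd) ,′ zero′ ,′ zero′) (fst ∙ fst) (con 2 ⊕ con 2 ⊗ 𝐱) compareStep-grows)
      (fst ∙ snd) (con 2 ⊕ con 2 ⊗ 𝐱) compareStep-grows ∙
    ((p ,′ D) ,′ (q ,′ S)))
  (λ γ → ⟦ apply p γ ⟧₂ * apply D γ ≤ᵇ ⟦ apply q γ ⟧₂ * apply S γ)
  (λ γ → compare-correct (apply D γ) (apply S γ) (apply p γ) (apply q γ))

-- The algorithm

one′ : ∀ {Γ} → Fun Γ nat
one′ = suc′ ∙ zero′

infix 7 _≡ᵇ′_

_≡ᵇ′_ : ∀ {Γ} → Fun Γ bits → Fun Γ bits → Fun Γ bool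
x ≡ᵇ′ y = computes (x * one′ ≤ᵇ′ y * one′ ∧′ y * one′ ≤ᵇ′ x * one′) (λ γ → ⟦ apply x γ ⟧₂ ≡ᵇ ⟦ apply y γ ⟧₂)
  λ γ → trans (cong₂ (λ m n → (m ≤ᵇ n) ∧ (n ≤ᵇ m)) (*-identityʳ ⟦ apply x γ ⟧₂) (*-identityʳ ⟦ apply y γ ⟧₂))
              (antisym ⟦ apply x γ ⟧₂ ⟦ apply y γ ⟧₂)
  where
  antisym : ∀ m n → (m ≤ᵇ n) ∧ (n ≤ᵇ m) ≡ (m ≡ᵇ n)
  antisym zero    zero    = refl
  antisym zero    (suc n) = refl
  antisym (suc m) zero    = refl
  antisym (suc m) (suc n) = trans (cong₂ _∧_ (≤ᵇ-suc m n) (≤ᵇ-suc n m)) (antisym m n)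

-- True exactly for the vertices that have colour `i` once all uncoloured vertices are given `i`.
admits : Maybe Bits → Bits → Bool
admits x i = maybe′ (λ j → ⟦ i ⟧₂ ≡ᵇ ⟦ j ⟧₂) true x

admits′ : ∀ {Γ} → Fun Γ (maybe bits) → Fun Γ bits → Fun Γ bool
admits′ x i = computes (branch maybeSplit x true′ (i ∙ fst ≡ᵇ′ snd)) (λ γ → admits (apply x γ) (apply i γ)) (λ _ → refl)

RawInstance : Type
RawInstance = (bits ⊠ bits) ⊠ list (list bool) ⊠ list bits ⊠ list (maybe bits)

-- The threshold is `p / q`, with its denominator cleared. A vertex is represented by its adjacency
-- row, whose true entries count the degree, and its prescribed colour.
satisfied : El RawInstance → Bits → List Bool × Maybe Bits → Bool
satisfied ((p , q) , _ , _ , cs) i (row , x) =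
  admits x i ∧
  (⟦ p ⟧₂ * length (filterᵇ id row) ≤ᵇ ⟦ q ⟧₂ * length (filterᵇ (λ (b , y) → b ∧ admits y i) (zip row cs)))

satisfied′ : Fun ((RawInstance ⊠ bits) ⊠ list bool ⊠ maybe bits) bool
satisfied′ = computes
  (admits′ (snd ∙ snd) (snd ∙ fst) ∧′
   (fst ∙ fst ∙ fst ∙ fst) * count′ snd (fst ∙ snd) ≤ᵇ′
   (snd ∙ fst ∙ fst ∙ fst) * count′ (fst ∙ snd ∧′ admits′ (snd ∙ snd) (snd ∙ fst ∙ fst))
                                    (zip′ (fst ∙ snd) (snd ∙ snd ∙ snd ∙ fst ∙ fst)))
  (λ ((I , i) , v) → satisfied I i v)
  (λ _ → refl)

-- Only the happy vertices of colour i are counted: this lower bound on the number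
-- of happy vertices suffices for the ratio, and the colouring need not be built.
score : El RawInstance → Bits → ℕ
score I@(_ , rows , _ , cs) i = length (filterᵇ (satisfied I i) (zip rows cs))

score′ : ∀ {Γ} → Fun Γ RawInstance → Fun Γ bits → Fun Γ nat
score′ I i = computes (count′ satisfied′ (zip′ (fst ∙ snd) (snd ∙ snd ∙ snd) ∙ fst) ∙ (I ,′ i))
                      (λ γ → score (apply I γ) (apply i γ)) (λ _ → refl)

better : {A : Set} → (A → ℕ) → A → A → A
better s i j = when s i ≤ᵇ s j then j else i

-- The value on an empty colour list is a mere default, since `k` is nonzero. Starting from `i` and
-- folding over `i ∷ is` compares the head with itself, so the program can fold over the colour list
-- as given.
best : El RawInstance → Bits
best I@(_ , _ , [] , _)     = []
best I@(_ , _ , i ∷ is , _) = List.foldl (better (score I)) i (i ∷ is)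

best′ : Fun RawInstance bits
best′ = computes
  (foldl′ (if′ score′ (fst ∙ fst) snd ≤ᵇ′ score′ (fst ∙ fst) (snd ∙ fst) then snd ∙ fst else snd)
          (branch listSplit (fst ∙ snd ∙ snd) nil′ (fst ∙ snd)) (fst ∙ snd ∙ snd) 𝐱 grows)
  best
  (λ { (_ , _ , [] , _) → refl ; (_ , _ , _ ∷ _ , _) → refl })
  where
  grows : ∀ I x a → sizeOf bits (better (score I) a x) ≤ sizeOf bits a + sizeOf (RawInstance ⊠ bits) (I , x)
  grows I x a with score I a ≤ᵇ score I x
  ... | true  = ≤-trans (m≤n+m _ (suc (sizeOf RawInstance I))) (m≤n+m _ (sizeOf bits a))
  ... | false = m≤m+n _ _

solve : El RawInstance → List Bits
solve I@(_ , _ , _ , cs) = List.map (fromMaybe (best I)) cs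

solve′ : Fun RawInstance (list bits)
solve′ = computes
  (let′ best′ in′ map′ (branch maybeSplit snd (snd ∙ fst) snd) (snd ∙ snd ∙ snd ∙ fst))
  solve
  (λ (_ , _ , _ , cs) → map-cong (λ { nothing → refl ; (just x) → refl }) cs)

-- Counting

count-mono : {A : Set} {P Q : A → Set} (P? : Decidable P) (Q? : Decidable Q) → (∀ {x} → P x → Q x) →
             ∀ xs → length (filter P? xs) ≤ length (filter Q? xs)
count-mono P? Q? P⊆Q []       = z≤n
count-mono P? Q? P⊆Q (x ∷ xs) with P? x | Q? x
... | yes p | yes q = s≤s (count-mono P? Q? P⊆Q xs)
... | yes p | no ¬q = contradiction (P⊆Q p) ¬q
... | no ¬p | yes q = m≤n⇒m≤1+n (count-mono P? Q? P⊆Q xs)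
... | no ¬p | no ¬q = count-mono P? Q? P⊆Q xs

filter-filter : {A : Set} {P Q : A → Set} (P? : Decidable P) (Q? : Decidable Q) →
                ∀ xs → filter P? (filter Q? xs) ≡ filter (Q? ∩? P?) xs
filter-filter P? Q? []       = refl
filter-filter P? Q? (x ∷ xs) with Q? x
... | no ¬q = filter-filter P? Q? xs
... | yes q with P? x
...   | yes p = cong (x ∷_) (filter-filter P? Q? xs)
...   | no ¬p = filter-filter P? Q? xs

count-map : {A B : Set} (f : A → B) (p : B → Bool) →
            ∀ xs → length (filterᵇ p (List.map f xs)) ≡ length (filterᵇ (p ∘ f) xs)
count-map f p []       = refl
count-map f p (x ∷ xs) with p (f x)
... | true  = cong suc (count-map f p xs)
... | false = count-map f p xs

sum-map-mono : {A : Set} {f g : A → ℕ} → (∀ x → f x ≤ g x) → ∀ xs → sum (List.map f xs) ≤ sum (List.map g xs)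
sum-map-mono f≤g []       = z≤n
sum-map-mono f≤g (x ∷ xs) = +-mono-≤ (f≤g x) (sum-map-mono f≤g xs)

sum-map-< : {A : Set} {f g : A → ℕ} → (∀ x → f x ≤ g x) → ∀ {y xs} → y ∈ xs → f y < g y →
            sum (List.map f xs) < sum (List.map g xs)
sum-map-< f≤g {xs = x ∷ xs} (here refl) fy<gy = +-mono-<-≤ fy<gy (sum-map-mono f≤g xs)
sum-map-< f≤g {xs = x ∷ xs} (there y∈)  fy<gy = +-mono-≤-< (f≤g x) (sum-map-< f≤g y∈ fy<gy)

sum-map-bounded : {A : Set} (f : A → ℕ) {m : ℕ} → (∀ x → f x ≤ m) → ∀ xs → sum (List.map f xs) ≤ length xs * m
sum-map-bounded f f≤m []       = z≤n
sum-map-bounded f f≤m (x ∷ xs) = +-mono-≤ (f≤m x) (sum-map-bounded f f≤m xs)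

count-∷ : {A : Set} {P : A → Set} (P? : Decidable P) → ∀ x xs → length (filter P? xs) ≤ length (filter P? (x ∷ xs))
count-∷ P? x xs with P? x
... | yes _ = n≤1+n _
... | no _  = ≤-refl

-- By induction on the list: an element satisfying `P` raises the left side by 1 and, being covered,
-- at least one summand on the right, while no summand ever drops.
count-cover : {A B : Set} {P : A → Set} {Q : B → A → Set} (P? : Decidable P) (Q? : ∀ b → Decidable (Q b)) →
              (bs : List B) → (∀ {x} → P x → ∃[ b ] b ∈ bs × Q b x) →
              ∀ xs → length (filter P? xs) ≤ sum (List.map (λ b → length (filter (Q? b) xs)) bs)
count-cover P? Q? bs cover []       = z≤n
count-cover {Q = Q} P? Q? bs cover (x ∷ xs) with P? x
... | no _  = ≤-trans (count-cover P? Q? bs cover xs) (sum-map-mono (λ b → count-∷ (Q? b) x xs) bs)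
... | yes p with cover p
...   | b₀ , b₀∈ , q₀ = ≤-<-trans (count-cover P? Q? bs cover xs) (sum-map-< (λ b → count-∷ (Q? b) x xs) b₀∈ strict)
  where
  strict : length (filter (Q? b₀) xs) < length (filter (Q? b₀) (x ∷ xs))
  strict with Q? b₀ x
  ... | yes _ = ≤-refl
  ... | no ¬q = contradiction q₀ ¬q

-- Encodings

digits : ℕᵇ → Bits
digits zero     = []
digits 2[1+ x ] = true ∷ digits x
digits 1+[2 x ] = false ∷ digits x

encode-digits : ∀ x → encode bits (digits x) ≡ encodeℕᵇ x
encode-digits zero     = refl
encode-digits 2[1+ x ] = cong (cons (cons nil nil)) (encode-digits x)
encode-digits 1+[2 x ] = cong (cons nil) (encode-digits x)

⟦digits⟧₂ : ∀ x → ⟦ digits x ⟧₂ ≡ ℕᵇ.toℕ x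
⟦digits⟧₂ zero     = refl
⟦digits⟧₂ 2[1+ x ] rewrite ⟦digits⟧₂ x = sym (*-suc 2 (ℕᵇ.toℕ x))
⟦digits⟧₂ 1+[2 x ] rewrite ⟦digits⟧₂ x = refl

binary : ℕ → Bits
binary n = digits (fromℕ n)

⟦binary⟧₂ : ∀ n → ⟦ binary n ⟧₂ ≡ n
⟦binary⟧₂ n = trans (⟦digits⟧₂ (fromℕ n)) (ℕᵇ.toℕ-fromℕ n)

colourBits : ∀ {k} → Fin k → Bits
colourBits i = binary (suc (toℕ i))

⟦colourBits⟧₂-injective : ∀ {k} {i j : Fin k} → ⟦ colourBits i ⟧₂ ≡ ⟦ colourBits j ⟧₂ → i ≡ j
⟦colourBits⟧₂-injective {i = i} {j} eq =
  Fin.toℕ-injective (suc-injective (trans (sym (⟦binary⟧₂ (suc (toℕ i)))) (trans eq (⟦binary⟧₂ (suc (toℕ j))))))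

raw : Instance → El RawInstance
raw I = (binary ∣ ↥ ρ ∣ , binary (↧ₙ ρ)) ,
        List.map (λ v → List.map (adj v) (allFin n)) (allFin n) ,
        List.map colourBits (allFin k) ,
        List.map (Maybe.map colourBits) (toList c)
  where open Instance I

encodeList-map : {A B : Set} {f : B → Data} {g : A → B} {h : A → Data} → (∀ x → f (g x) ≡ h x) →
                 ∀ xs → encodeList f (List.map g xs) ≡ encodeList h xs
encodeList-map eq []       = refl
encodeList-map eq (x ∷ xs) = cong₂ cons (eq x) (encodeList-map eq xs)

encode-raw : ∀ I → encode RawInstance (raw I) ≡ encodeInstance I
encode-raw I = cong₂ cons (cong₂ cons (encode-digits _) (encode-digits _))
  (cong₂ cons (encodeList-map (λ v → encodeList-map (λ _ → refl) (allFin n)) (allFin n))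
  (cong₂ cons (encodeList-map (λ i → encode-digits _) (allFin k))
              (encodeList-map (λ { nothing → refl ; (just i) → cong (cons nil) (encode-digits _) }) (toList c))))
  where open Instance I

zip-tabulate : {A B : Set} → ∀ {n} (f : Fin n → A) (xs : Vec B n) →
               zip (tabulate f) (toList xs) ≡ tabulate (λ v → f v , lookup xs v)
zip-tabulate f []       = refl
zip-tabulate f (x ∷ xs) = cong (_ ∷_) (zip-tabulate (f ∘ suc) xs)

zip-map : {A B C : Set} → ∀ {n} (f : Fin n → A) (g : B → C) (xs : Vec B n) →
          zip (List.map f (allFin n)) (List.map g (toList xs)) ≡ List.map (λ v → f v , g (lookup xs v)) (allFin n)
zip-map {n = n} f g xs = begin
  zip (List.map f (allFin n)) (List.map g (toList xs))          ≡⟨ cong₂ zip (map-tabulate id f) (sym (Vec.toList-map g xs)) ⟩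
  zip (tabulate f) (toList (Vec.map g xs))                      ≡⟨ zip-tabulate f (Vec.map g xs) ⟩
  tabulate (λ v → f v , lookup (Vec.map g xs) v)                ≡⟨ tabulate-cong (λ v → cong (f v ,_) (Vec.lookup-map v g xs)) ⟩
  tabulate (λ v → f v , g (lookup xs v))                        ≡⟨ map-tabulate id _ ⟨
  List.map (λ v → f v , g (lookup xs v)) (allFin n)             ∎
  where open ≡-Reasoning

-- Rational thresholds

-- Products of unnormalised rationals are not reduced, so there the inequality unfolds to one
-- between integers. The fraction need not be in lowest terms, so that both `ρ` and `1 / k` are
-- instances.
fromℚᵘ-*-≤ : ∀ p q d s → (fromℚᵘ (mkℚᵘ (+ p) q) ℚ.* (+ d / 1) ℚ.≤ + s / 1 → p * d ≤ suc q * s) ×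
                         (p * d ≤ suc q * s → fromℚᵘ (mkℚᵘ (+ p) q) ℚ.* (+ d / 1) ℚ.≤ + s / 1)
fromℚᵘ-*-≤ p q d s = forward , backward
  where
  lhs : toℚᵘ (fromℚᵘ (mkℚᵘ (+ p) q) ℚ.* (+ d / 1)) ℚᵘ.≃ mkℚᵘ (+ p) q ℚᵘ.* mkℚᵘ (+ d) 0
  lhs = ℚᵘ.≃-trans (ℚ.toℚᵘ-homo-* (fromℚᵘ (mkℚᵘ (+ p) q)) (+ d / 1))
                   (ℚᵘ.*-cong (ℚ.toℚᵘ-fromℚᵘ (mkℚᵘ (+ p) q)) (ℚ.toℚᵘ-fromℚᵘ (mkℚᵘ (+ d) 0)))

  rhs : toℚᵘ (+ s / 1) ℚᵘ.≃ mkℚᵘ (+ s) 0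
  rhs = ℚ.toℚᵘ-fromℚᵘ (mkℚᵘ (+ s) 0)

  left : + p ℤ.* + d ℤ.* + 1 ≡ + (p * d)
  left = trans (ℤ.*-identityʳ _) (sym (ℤ.pos-* p d))

  right : + s ℤ.* + (suc q * 1) ≡ + (suc q * s)
  right = trans (sym (ℤ.pos-* s (suc q * 1))) (cong +_ (trans (cong (s *_) (*-identityʳ (suc q))) (*-comm s (suc q))))

  forward : _ → p * d ≤ suc q * s
  forward ≤ = ℤ.drop‿+≤+ (subst₂ ℤ._≤_ left right (ℚᵘ.drop-*≤*
    (ℚᵘ.≤-respʳ-≃ rhs (ℚᵘ.≤-respˡ-≃ lhs (ℚ.toℚᵘ-mono-≤ ≤)))))

  backward : p * d ≤ suc q * s → _
  backward ≤ = ℚ.toℚᵘ-cancel-≤ (ℚᵘ.≤-respʳ-≃ (ℚᵘ.≃-sym rhs) (ℚᵘ.≤-respˡ-≃ (ℚᵘ.≃-sym lhs)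
    (*≤* (subst₂ ℤ._≤_ (sym left) (sym right) (ℤ.+≤+ ≤)))))

-- Positivity excludes a negative numerator, whose sign `∣ ↥ ρ ∣` would lose.
positive-*-≤ : ∀ ρ → 0ℚ ℚ.< ρ → ∀ d s → (ρ ℚ.* (+ d / 1) ℚ.≤ + s / 1 → ∣ ↥ ρ ∣ * d ≤ ↧ₙ ρ * s) ×
                                          (∣ ↥ ρ ∣ * d ≤ ↧ₙ ρ * s → ρ ℚ.* (+ d / 1) ℚ.≤ + s / 1)
positive-*-≤ ρ@(mkℚ (+ p) q _) 0<ρ d s = subst (λ α → (α ℚ.* (+ d / 1) ℚ.≤ + s / 1 → p * d ≤ suc q * s) ×
                                                      (p * d ≤ suc q * s → α ℚ.* (+ d / 1) ℚ.≤ + s / 1))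
                                               (ℚ.fromℚᵘ-toℚᵘ ρ) (fromℚᵘ-*-≤ p q d s)
positive-*-≤ (mkℚ -[1+ p ] q _) (ℚ.*<* ()) d s

-- Maximising over the colours

foldl-better : {A : Set} (s : A → ℕ) → ∀ a xs → let b = List.foldl (better s) a xs in
               s a ≤ s b × (∀ {x} → x ∈ xs → s x ≤ s b)
foldl-better s a []       = ≤-refl , λ ()
foldl-better s a (x ∷ xs) with s a ≤ᵇ s x in eq
... | true =
  let x≤b , xs≤b = foldl-better s x xs
  in ≤-trans (≤ᵇ⇒≤ (s a) (s x) (subst T (sym eq) tt)) x≤b , λ { (here refl) → x≤b ; (there y∈) → xs≤b y∈ }
... | false =
  let a≤b , xs≤b = foldl-better s a xs
  in a≤b , λ { (here refl) → ≤-trans (<⇒≤ (≰⇒> λ a≤x → subst T eq (≤⇒≤ᵇ a≤x))) a≤b ; (there y∈) → xs≤b y∈ }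

foldl-better-map : {A B : Set} (f : A → B) (s : B → ℕ) → ∀ a xs →
                   List.foldl (better s) (f a) (List.map f xs) ≡ f (List.foldl (better (s ∘ f)) a xs)
foldl-better-map f s a []       = refl
foldl-better-map f s a (x ∷ xs) with s (f a) ≤ᵇ s (f x)
... | true  = foldl-better-map f s x xs
... | false = foldl-better-map f s a xs

-- The winner among bit strings encodes an actual colour because the fold commutes with
-- `colourBits`. The colour list enters through an equation so that `k`, a projection in the
-- intended use, can be matched as a successor.
argBest : ∀ R {k} .{{_ : NonZero k}} → proj₁ (proj₂ (proj₂ R)) ≡ List.map colourBits (allFin k) →
          ∃[ j ] best R ≡ colourBits {k} j × (∀ i → score R (colourBits {k} i) ≤ score R (colourBits j))
argBest R@(_ , _ , _ , _) {suc k} refl =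
  List.foldl (better (score R ∘ colourBits)) zero (allFin (suc k)) ,
  foldl-better-map colourBits (score R) zero (allFin (suc k)) ,
  λ i → proj₂ (foldl-better (score R ∘ colourBits) zero (allFin (suc k))) (∈-allFin i)

-- The approximation ratio

module Correctness (I : Instance) where
  open Instance I hiding (sym)

  allows : Fin k → Fin n → Bool
  allows i v = admits (Maybe.map colourBits (lookup c v)) (colourBits i)

  -- The most neighbours of `v` that can have colour `i` in any extension; `fill i` attains this for
  -- all vertices simultaneously.
  potential : Fin k → Fin n → ℕ
  potential i v = length (filterᵇ (λ u → adj v u ∧ allows i u) (allFin n))

  satisfiable : Fin k → Fin n → Bool
  satisfiable i v = allows i v ∧ (∣ ↥ ρ ∣ * deg v ≤ᵇ ↧ₙ ρ * potential i v)

  numSatisfiable : Fin k → ℕ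
  numSatisfiable i = length (filterᵇ (satisfiable i) (allFin n))

  row : Fin n → List Bool
  row v = List.map (adj v) (allFin n)

  satisfied-raw : ∀ i v →
    satisfied (raw I) (colourBits i) (row v , Maybe.map colourBits (lookup c v)) ≡ satisfiable i v
  satisfied-raw i v = cong (allows i v ∧_) (cong₂ _≤ᵇ_
    (cong₂ _*_ (⟦binary⟧₂ ∣ ↥ ρ ∣) (count-map (adj v) id (allFin n)))
    (cong₂ _*_ (⟦binary⟧₂ (↧ₙ ρ)) (trans
      (cong (λ xs → length (filterᵇ (λ (b , y) → b ∧ admits y (colourBits i)) xs))
            (zip-map (adj v) (Maybe.map colourBits) c))
      (count-map (λ u → adj v u , Maybe.map colourBits (lookup c u)) _ (allFin n)))))

  score-raw : ∀ i → score (raw I) (colourBits i) ≡ numSatisfiable i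
  score-raw i = begin
    length (filterᵇ sat (zip (List.map row (allFin n)) (List.map (Maybe.map colourBits) (toList c))))
      ≡⟨ cong (length ∘ filterᵇ sat) (zip-map row (Maybe.map colourBits) c) ⟩
    length (filterᵇ sat (List.map (λ v → row v , Maybe.map colourBits (lookup c v)) (allFin n)))
      ≡⟨ count-map _ sat (allFin n) ⟩
    length (filterᵇ (λ v → sat (row v , Maybe.map colourBits (lookup c v))) (allFin n))
      ≡⟨ cong length (filter-≐ _ _ ( (λ {v} → subst T (satisfied-raw i v))
                                   , (λ {v} → subst T (sym (satisfied-raw i v)))) (allFin n)) ⟩
    numSatisfiable i ∎
    where
    open ≡-Reasoning
    sat : List Bool × Maybe Bits → Bool
    sat = satisfied (raw I) (colourBits i)

  fill : Fin k → TotalColouring I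
  fill i = Vec.map (fromMaybe i) c

  lookup-fill : ∀ i v → lookup (fill i) v ≡ fromMaybe i (lookup c v)
  lookup-fill i v = Vec.lookup-map v (fromMaybe i) c

  fill-extends : ∀ i → Extends I (fill i)
  fill-extends i v with lookup c v | lookup-fill i v
  ... | nothing | _  = MaybeAll.nothing
  ... | just j  | eq = MaybeAll.just eq

  allows⇒fill : ∀ i v → T (allows i v) → lookup (fill i) v ≡ i
  allows⇒fill i v a with lookup c v | lookup-fill i v
  ... | nothing | eq = eq
  ... | just j  | eq = trans eq (⟦colourBits⟧₂-injective (sym (≡ᵇ⇒≡ _ _ a)))

  extends⇒allows : ∀ c′ → Extends I c′ → ∀ v → T (allows (lookup c′ v) v)
  extends⇒allows c′ ext v with lookup c v | ext v
  ... | nothing | _                = tt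
  ... | just j  | MaybeAll.just eq = ≡⇒≡ᵇ _ _ (cong (⟦_⟧₂ ∘ colourBits) eq)

  happy⇒satisfiable : ∀ c′ → Extends I c′ → ∀ {v} → Happy I c′ v → T (satisfiable (lookup c′ v) v)
  happy⇒satisfiable c′ ext {v} h = Equivalence.from T-∧ (extends⇒allows c′ ext v , ≤⇒≤ᵇ (≤-trans
    (proj₁ (positive-*-≤ ρ 0<ρ (deg v) _) h)
    (*-monoʳ-≤ (↧ₙ ρ) (≤-trans (≤-reflexive (cong length (filter-filter _ _ (allFin n))))
      (count-mono _ _ (λ {u} (adj , same) →
         Equivalence.from T-∧ (adj , subst (λ i → T (allows i u)) same (extends⇒allows c′ ext u))) (allFin n))))))

  satisfiable⇒happy : ∀ i {v} → T (satisfiable i v) → Happy I (fill i) v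
  satisfiable⇒happy i {v} s with Equivalence.to T-∧ s
  ... | a , ≤ = proj₂ (positive-*-≤ ρ 0<ρ (deg v) _) (≤-trans (≤ᵇ⇒≤ _ _ ≤)
    (*-monoʳ-≤ (↧ₙ ρ) (≤-trans
      (count-mono _ _ (λ {u} t → let adj , b = Equivalence.to T-∧ t in
         adj , trans (allows⇒fill i u b) (sym (allows⇒fill i v a))) (allFin n))
      (≤-reflexive (cong length (sym (filter-filter _ _ (allFin n))))))))

  module _ (j : Fin k) (j-best : ∀ i → numSatisfiable i ≤ numSatisfiable j) where

    numHappy-bound : ∀ c′ → Extends I c′ → numHappy I c′ ≤ k * numHappy I (fill j)
    numHappy-bound c′ ext = begin
      numHappy I c′
        -- Each happy vertex is charged to its own colour in `c′`.
        ≤⟨ count-cover (happy? I c′) (λ i → T? ∘ satisfiable i) (allFin k)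
             (λ {v} h → lookup c′ v , ∈-allFin _ , happy⇒satisfiable c′ ext h) (allFin n) ⟩
      sum (List.map numSatisfiable (allFin k))
        ≤⟨ sum-map-bounded numSatisfiable j-best (allFin k) ⟩
      length (allFin k) * numSatisfiable j
        ≡⟨ cong (_* numSatisfiable j) (length-tabulate {n = k} id) ⟩
      k * numSatisfiable j
        ≤⟨ *-monoʳ-≤ k (count-mono _ (happy? I (fill j)) (satisfiable⇒happy j) (allFin n)) ⟩
      k * numHappy I (fill j) ∎
      where open ≤-Reasoning

    OPT-bound : OPT I ≤ k * numHappy I (fill j)
    -- `z≤n` handles the default value 0 of the maximum.
    OPT-bound = max≤v⁺ z≤n (All.map⁺ (All.map (λ {c′} → numHappy-bound c′)
                                             (All.all-filter (extends? I) (allVecs (allFin k) n))))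

    approximation : IsApproximation I (+ 1 / k) (fill j)
    approximation = fill-extends j , scaled k OPT-bound
      where
      -- Quantifying over `k` afresh allows matching it as a successor, for which `+ 1 / k` has the
      -- form `fromℚᵘ`.
      scaled : ∀ k .{{_ : NonZero k}} {d s} → d ≤ k * s → (+ 1 / k) ℚ.* (+ d / 1) ℚ.≤ + s / 1
      scaled (suc k) {d} {s} d≤ = proj₂ (fromℚᵘ-*-≤ 1 k d s) (≤-trans (≤-reflexive (*-identityˡ d)) d≤)

  solution : Σ[ c′ ∈ TotalColouring I ]
             encode (list bits) (solve (raw I)) ≡ encodeColouring {I} c′ × IsApproximation I (+ 1 / k) c′
  solution = fill j , encodes ,
             approximation j λ i → subst₂ _≤_ (score-raw i) (score-raw j) (proj₂ (proj₂ chosen) i)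
    where
    chosen : ∃[ j ] best (raw I) ≡ colourBits {k} j ×
                    (∀ i → score (raw I) (colourBits {k} i) ≤ score (raw I) (colourBits j))
    chosen = argBest (raw I) refl

    j : Fin k
    j = proj₁ chosen

    encodes : encode (list bits) (solve (raw I)) ≡ encodeColouring {I} (fill j)
    encodes = begin
      encodeList (encode bits) (List.map (fromMaybe (best (raw I))) (List.map (Maybe.map colourBits) (toList c)))
        ≡⟨ cong (λ b → encodeList (encode bits) (List.map (fromMaybe b) (List.map (Maybe.map colourBits) (toList c))))
                (proj₁ (proj₂ chosen)) ⟩
      encodeList (encode bits) (List.map (fromMaybe (colourBits j)) (List.map (Maybe.map colourBits) (toList c)))
        ≡⟨ cong (encodeList (encode bits)) (map-∘ (toList c)) ⟨
      encodeList (encode bits) (List.map (fromMaybe (colourBits j) ∘ Maybe.map colourBits) (toList c))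
        ≡⟨ encodeList-map (λ { nothing → encode-digits _ ; (just i) → encode-digits _ }) (toList c) ⟩
      encodeList (encodeColour ∘ fromMaybe j) (toList c)
        ≡⟨ encodeList-map (λ _ → refl) (toList c) ⟨
      encodeList encodeColour (List.map (fromMaybe j) (toList c))
        ≡⟨ cong (encodeList encodeColour) (Vec.toList-map (fromMaybe j) c) ⟨
      encodeColouring {I} (fill j) ∎
      where open ≡-Reasoning

solvable : ∀ {A B} {Inst : Set} {Sol : Inst → Set}
           {encodeInst : Inst → Data} {encodeSol : ∀ {I} → Sol I → Data} {R : (I : Inst) → Sol I → Set}
           (f : Fun A B) (input : Inst → El A) → (∀ I → encode A (input I) ≡ encodeInst I) →
           (∀ I → Σ[ s ∈ Sol I ] encode B (apply f (input I)) ≡ encodeSol s × R I s) →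
           SolvableInPolynomialTime encodeInst (λ {I} → encodeSol {I}) R
solvable {A} {B} {encodeInst = encodeInst} {encodeSol} f input encode≡ output =
  let a , d , time≤ = monomialBound (time f)
  -- The one extra variable is the stack, initially `nil`.
  in program 1 (code f) , suc a , 0 , d , λ I →
    let s , encodeSol≡ , r = output I
        t , runs , t≤ = subst₂ (λ x y → Runs (code f) (x ∷ nil ∷ []) (y ∷ nil ∷ []) (time f ⟨ size x ⟩))
                               (encode≡ I) encodeSol≡ (correct f (input I) nil)
    in s , t , (nil ∷ [] , runs) ,
       -- The monomial bound holds at nonzero arguments, and every tree has size at least 1.
       ≤-trans t≤ (≤-trans (time≤ (size (encodeInst I)) {{>-nonZero (size≥1 (encodeInst I))}}) (m≤m+n _ 0)) ,
       r

theoremB1 : SoftMHV-ApproximableInPolynomialTime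
    (λ I → let open Instance I in + 1 / k)
theoremB1 = solvable solve′ raw encode-raw Correctness.solution
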